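{- In dimension $6$, every strictly balanced inequality for $h^*$-polynomials of lattice polytopes containing an interior lattice point can be deduced from the following inequalities: (1) $h^*_6\le h^*_1\le h^*_5\le h^*_2$; (2) $h^*_1+h^*_2\le h^*_4+h^*_5\le h^*_2+h^*_3$; (3) $h^*_1+h^*_2\le h^*_3+h^*_4$.
   Context: A lattice polytope is a polytope with vertices in $\mathbb{Z}^d$. For a $d$-dimensional lattice polytope $P\subseteq\mathbb{R}^d$, let $f_P(m)=|mP\cap\mathbb{Z}^d|$. Its $h^*$-polynomial $h^*(t)=h^*_0+h^*_1t+\cdots+h^*_dt^d$ is the polynomial of degree at most $d$ with $\sum_{m\ge0}f_P(m)t^m=\frac{h^*(t)}{(1-t)^{d+1}}$. A strictly balanced inequality (in dimension $d$) for $h^*$-polynomials of lattice polytopes containing an interior lattice point is an inequality $\sum_{i=1}^d\alpha_ih^*_i\ge0$ with real coefficients satisfying $\sum_{i=1}^d\alpha_i=0$ that holds for the $h^*$-polynomial of every $d$-dimensional lattice polytope $P\subseteq\mathbb{R}^d$ containing an interior lattice point. It can be deduced from a given system of linear inequalities in $h^*_1,\ldots,h^*_d$ if it holds for every real vector $(h^*_1,\ldots,h^*_d)$ satisfying the system. -}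

module Defs where

open import Level using (0ℓ)
open import Algebra.Bundles using (CommutativeMonoid)
open import Algebra.Bundles.Raw using (RawMonoid)
import Algebra.Definitions.RawMonoid as RawMonoidDefinitions
open import Data.Nat.Base as ℕ using (ℕ; zero; suc)
import Data.Nat.Properties as ℕ
open import Data.Integer.Base as ℤ using (ℤ; +_)
import Data.Integer.Properties as ℤ
open import Data.Rational.Base as ℚ using (ℚ; 0ℚ; 1ℚ; ½)
import Data.Rational.Properties as ℚ
open import Data.Fin.Base using (Fin; suc; toℕ)
open import Data.Fin.Patterns using (0F; 1F; 2F; 3F; 4F; 5F)
open import Data.Vec.Base using (Vec; []; _∷_; lookup)
open import Data.Vec.Functional using (Vector)
open import Data.List.Base using (List; length)
open import Data.List.Membership.Propositional using (_∈_)
open import Data.List.Relation.Unary.Unique.Propositional using (Unique)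
open import Data.Product.Base using (∃; _×_; _,_)
open import Function.Bundles using (_⇔_)
open import Relation.Binary.PropositionalEquality
  using (_≡_; sym; trans; cong; subst; module ≡-Reasoning)
open import Relation.Unary using (Pred)
open import Algebra.Properties.AbelianGroup ℚ.+-0-abelianGroup using (xyx⁻¹≈y)
open import Algebra.Properties.CommutativeSemigroup
  (CommutativeMonoid.commutativeSemigroup ℚ.+-0-commutativeMonoid)
  using (interchange)
open import Algebra.Properties.Ring ℚ.+-*-ring using (x[y-z]≈xy-xz; [y-z]x≈yx-zx)

------------------------------------------------------------------------
-- Real numbers: Cauchy sequences of rationals, identified up to _≃_

IsCauchy : (ℕ → ℚ) → Set
IsCauchy s = ∀ ε → 0ℚ ℚ.< ε →
  ∃ λ N → ∀ m n → N ℕ.≤ m → N ℕ.≤ n → ℚ.∣ s m ℚ.- s n ∣ ℚ.≤ ε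

record ℝ : Set where
  constructor mkℝ
  field
    seq    : ℕ → ℚ
    cauchy : IsCauchy seq

open ℝ public

infix 4 _≃_ _≤_

record _≃_ (x y : ℝ) : Set where
  constructor *≃*
  field
    close : ∀ ε → 0ℚ ℚ.< ε →
      ∃ λ N → ∀ n → N ℕ.≤ n → ℚ.∣ seq x n ℚ.- seq y n ∣ ℚ.≤ ε

record _≤_ (x y : ℝ) : Set where
  constructor *≤*
  field
    below : ∀ ε → 0ℚ ℚ.< ε →
      ∃ λ N → ∀ n → N ℕ.≤ n → seq x n ℚ.≤ seq y n ℚ.+ ε

fromℚ : ℚ → ℝ
fromℚ q = mkℝ (λ _ → q) λ ε 0<ε → 0 , λ _ _ _ _ →
  subst (ℚ._≤ ε) (sym (cong ℚ.∣_∣ (ℚ.+-inverseʳ q))) (ℚ.<⇒≤ 0<ε)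

fromℤ : ℤ → ℝ
fromℤ k = fromℚ (k ℚ./ 1)

fromℕ : ℕ → ℝ
fromℕ n = fromℤ (+ n)

0ℝ 1ℝ : ℝ
0ℝ = fromℚ 0ℚ
1ℝ = fromℚ 1ℚ

private
  *-pos : ∀ p q → 0ℚ ℚ.< p → 0ℚ ℚ.< q → 0ℚ ℚ.< p ℚ.* q
  *-pos p q 0<p 0<q = ℚ.positive⁻¹ (p ℚ.* q)
    {{ℚ.pos*pos⇒pos p {{ℚ.positive 0<p}} q {{ℚ.positive 0<q}}}}

  ½-pos : ∀ ε → 0ℚ ℚ.< ε → 0ℚ ℚ.< ½ ℚ.* ε
  ½-pos ε = *-pos ½ ε (ℚ.positive⁻¹ ½)

  halves : ∀ ε → ½ ℚ.* ε ℚ.+ ½ ℚ.* ε ≡ ε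
  halves ε = trans (sym (ℚ.*-distribʳ-+ ε ½ ½)) (ℚ.*-identityˡ ε)

  *-mono : ∀ {a b c d} → 0ℚ ℚ.≤ c → 0ℚ ℚ.≤ b →
           a ℚ.≤ b → c ℚ.≤ d → a ℚ.* c ℚ.≤ b ℚ.* d
  *-mono {a} {b} {c} {d} 0≤c 0≤b a≤b c≤d = ℚ.≤-trans
    (ℚ.*-monoʳ-≤-nonNeg c {{ℚ.nonNegative 0≤c}} a≤b)
    (ℚ.*-monoˡ-≤-nonNeg b {{ℚ.nonNegative 0≤b}} c≤d)

  +-split : ∀ a b c d → (a ℚ.+ b) ℚ.- (c ℚ.+ d) ≡ (a ℚ.- c) ℚ.+ (b ℚ.- d)
  +-split a b c d = trans (cong (a ℚ.+ b ℚ.+_) (ℚ.neg-distrib-+ c d))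
    (interchange a b (ℚ.- c) (ℚ.- d))

  cancel : ∀ p q → q ≡ p ℚ.+ (q ℚ.- p)
  cancel p q = trans (sym (xyx⁻¹≈y p q)) (ℚ.+-assoc p q (ℚ.- p))

  telescope : ∀ p q r → p ℚ.- r ≡ (p ℚ.- q) ℚ.+ (q ℚ.- r)
  telescope p q r = begin
    p ℚ.- r                       ≡⟨ cong (ℚ._- r) (trans (cancel q p) (ℚ.+-comm q (p ℚ.- q))) ⟩
    ((p ℚ.- q) ℚ.+ q) ℚ.- r       ≡⟨ ℚ.+-assoc (p ℚ.- q) q (ℚ.- r) ⟩
    (p ℚ.- q) ℚ.+ (q ℚ.- r)       ∎
    where open ≡-Reasoning

  *-split : ∀ a b c d → a ℚ.* b ℚ.- c ℚ.* d ≡ a ℚ.* (b ℚ.- d) ℚ.+ (a ℚ.- c) ℚ.* d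
  *-split a b c d = trans (telescope (a ℚ.* b) (a ℚ.* d) (c ℚ.* d))
    (sym (trans
      (cong (ℚ._+ (a ℚ.- c) ℚ.* d) (x[y-z]≈xy-xz a b d))
      (cong (a ℚ.* b ℚ.- a ℚ.* d ℚ.+_) ([y-z]x≈yx-zx d a c))))

  EventuallyBounded : (ℕ → ℚ) → ℚ → Set
  EventuallyBounded s B = ∃ λ N → ∀ n → N ℕ.≤ n → ℚ.∣ s n ∣ ℚ.≤ B

  bounded : ∀ s → IsCauchy s → ∃ λ B → 0ℚ ℚ.< B × EventuallyBounded s B
  bounded s c with N , h ← c 1ℚ (ℚ.positive⁻¹ 1ℚ) =
    ℚ.∣ s N ∣ ℚ.+ 1ℚ ,
    ℚ.+-mono-≤-< (ℚ.0≤∣p∣ (s N)) (ℚ.positive⁻¹ 1ℚ) ,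
    N , λ n N≤n → begin
      ℚ.∣ s n ∣                         ≡⟨ cong ℚ.∣_∣ (cancel (s N) (s n)) ⟩
      ℚ.∣ s N ℚ.+ (s n ℚ.- s N) ∣       ≤⟨ ℚ.∣p+q∣≤∣p∣+∣q∣ (s N) (s n ℚ.- s N) ⟩
      ℚ.∣ s N ∣ ℚ.+ ℚ.∣ s n ℚ.- s N ∣   ≤⟨ ℚ.+-monoʳ-≤ ℚ.∣ s N ∣ (h n N N≤n ℕ.≤-refl) ⟩
      ℚ.∣ s N ∣ ℚ.+ 1ℚ                  ∎
    where open ℚ.≤-Reasoning

  +-cauchy : ∀ s t → IsCauchy s → IsCauchy t → IsCauchy (λ n → s n ℚ.+ t n)
  +-cauchy s t cs ct ε 0<ε
    with N , hs ← cs (½ ℚ.* ε) (½-pos ε 0<ε)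
       | M , ht ← ct (½ ℚ.* ε) (½-pos ε 0<ε) =
    N ℕ.⊔ M , λ m n ≤m ≤n → begin
      ℚ.∣ (s m ℚ.+ t m) ℚ.- (s n ℚ.+ t n) ∣
        ≡⟨ cong ℚ.∣_∣ (+-split (s m) (t m) (s n) (t n)) ⟩
      ℚ.∣ (s m ℚ.- s n) ℚ.+ (t m ℚ.- t n) ∣
        ≤⟨ ℚ.∣p+q∣≤∣p∣+∣q∣ (s m ℚ.- s n) (t m ℚ.- t n) ⟩
      ℚ.∣ s m ℚ.- s n ∣ ℚ.+ ℚ.∣ t m ℚ.- t n ∣
        ≤⟨ ℚ.+-mono-≤ (hs m n (ℕ.m⊔n≤o⇒m≤o N M ≤m) (ℕ.m⊔n≤o⇒m≤o N M ≤n))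
                      (ht m n (ℕ.m⊔n≤o⇒n≤o N M ≤m) (ℕ.m⊔n≤o⇒n≤o N M ≤n)) ⟩
      ½ ℚ.* ε ℚ.+ ½ ℚ.* ε
        ≡⟨ halves ε ⟩
      ε ∎
    where open ℚ.≤-Reasoning

  -- For 0 < B and 0 < ε there is δ > 0 with B * δ = ε.
  divide : ∀ B ε → 0ℚ ℚ.< B → 0ℚ ℚ.< ε → ∃ λ δ → 0ℚ ℚ.< δ × B ℚ.* δ ≡ ε
  divide B ε 0<B 0<ε =
    1/B ℚ.* ε ,
    *-pos 1/B ε (ℚ.positive⁻¹ 1/B {{ℚ.1/pos⇒pos B {{ℚ.positive 0<B}}}}) 0<ε ,
    trans (sym (ℚ.*-assoc B 1/B ε))
      (trans (cong (ℚ._* ε) (ℚ.*-inverseʳ B {{B≢0}})) (ℚ.*-identityˡ ε))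
    where
    B≢0 : ℚ.NonZero B
    B≢0 = ℚ.pos⇒nonZero B {{ℚ.positive 0<B}}
    1/B : ℚ
    1/B = (ℚ.1/ B) {{B≢0}}

  *-cauchy : ∀ s t → IsCauchy s → IsCauchy t → IsCauchy (λ n → s n ℚ.* t n)
  *-cauchy s t cs ct ε 0<ε
    with B , 0<B , N₁ , bs ← bounded s cs
       | C , 0<C , N₂ , bt ← bounded t ct
    with δ , 0<δ , Bδ≡ ← divide B (½ ℚ.* ε) 0<B (½-pos ε 0<ε)
       | η , 0<η , Cη≡ ← divide C (½ ℚ.* ε) 0<C (½-pos ε 0<ε)
    with N₃ , ht ← ct δ 0<δ
       | N₄ , hs ← cs η 0<η =
    (N₁ ℕ.⊔ N₂) ℕ.⊔ (N₃ ℕ.⊔ N₄) , λ m n ≤m ≤n →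
    let l₁ : ∀ {k} → (N₁ ℕ.⊔ N₂) ℕ.⊔ (N₃ ℕ.⊔ N₄) ℕ.≤ k → N₁ ℕ.⊔ N₂ ℕ.≤ k
        l₁ = ℕ.m⊔n≤o⇒m≤o (N₁ ℕ.⊔ N₂) (N₃ ℕ.⊔ N₄)
        l₂ : ∀ {k} → (N₁ ℕ.⊔ N₂) ℕ.⊔ (N₃ ℕ.⊔ N₄) ℕ.≤ k → N₃ ℕ.⊔ N₄ ℕ.≤ k
        l₂ = ℕ.m⊔n≤o⇒n≤o (N₁ ℕ.⊔ N₂) (N₃ ℕ.⊔ N₄)
    in begin
      ℚ.∣ s m ℚ.* t m ℚ.- s n ℚ.* t n ∣
        ≡⟨ cong ℚ.∣_∣ (*-split (s m) (t m) (s n) (t n)) ⟩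
      ℚ.∣ s m ℚ.* (t m ℚ.- t n) ℚ.+ (s m ℚ.- s n) ℚ.* t n ∣
        ≤⟨ ℚ.∣p+q∣≤∣p∣+∣q∣ (s m ℚ.* (t m ℚ.- t n)) ((s m ℚ.- s n) ℚ.* t n) ⟩
      ℚ.∣ s m ℚ.* (t m ℚ.- t n) ∣ ℚ.+ ℚ.∣ (s m ℚ.- s n) ℚ.* t n ∣
        ≡⟨ cong (ℚ._+ ℚ.∣ (s m ℚ.- s n) ℚ.* t n ∣) (ℚ.∣p*q∣≡∣p∣*∣q∣ (s m) (t m ℚ.- t n)) ⟩
      ℚ.∣ s m ∣ ℚ.* ℚ.∣ t m ℚ.- t n ∣ ℚ.+ ℚ.∣ (s m ℚ.- s n) ℚ.* t n ∣
        ≡⟨ cong (ℚ.∣ s m ∣ ℚ.* ℚ.∣ t m ℚ.- t n ∣ ℚ.+_)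
             (trans (ℚ.∣p*q∣≡∣p∣*∣q∣ (s m ℚ.- s n) (t n)) (ℚ.*-comm ℚ.∣ s m ℚ.- s n ∣ ℚ.∣ t n ∣)) ⟩
      ℚ.∣ s m ∣ ℚ.* ℚ.∣ t m ℚ.- t n ∣ ℚ.+ ℚ.∣ t n ∣ ℚ.* ℚ.∣ s m ℚ.- s n ∣
        ≤⟨ ℚ.+-mono-≤
             (*-mono (ℚ.0≤∣p∣ (t m ℚ.- t n)) (ℚ.<⇒≤ 0<B)
               (bs m (ℕ.m⊔n≤o⇒m≤o N₁ N₂ (l₁ ≤m)))
               (ht m n (ℕ.m⊔n≤o⇒m≤o N₃ N₄ (l₂ ≤m)) (ℕ.m⊔n≤o⇒m≤o N₃ N₄ (l₂ ≤n))))
             (*-mono (ℚ.0≤∣p∣ (s m ℚ.- s n)) (ℚ.<⇒≤ 0<C)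
               (bt n (ℕ.m⊔n≤o⇒n≤o N₁ N₂ (l₁ ≤n)))
               (hs m n (ℕ.m⊔n≤o⇒n≤o N₃ N₄ (l₂ ≤m)) (ℕ.m⊔n≤o⇒n≤o N₃ N₄ (l₂ ≤n)))) ⟩
      B ℚ.* δ ℚ.+ C ℚ.* η
        ≡⟨ cong (ℚ._+ C ℚ.* η) Bδ≡ ⟩
      ½ ℚ.* ε ℚ.+ C ℚ.* η
        ≡⟨ cong (½ ℚ.* ε ℚ.+_) Cη≡ ⟩
      ½ ℚ.* ε ℚ.+ ½ ℚ.* ε
        ≡⟨ halves ε ⟩
      ε ∎
    where open ℚ.≤-Reasoning

infixl 6 _+_
infixl 7 _*_

_+_ : ℝ → ℝ → ℝ
x + y = mkℝ (λ n → seq x n ℚ.+ seq y n) (+-cauchy (seq x) (seq y) (cauchy x) (cauchy y))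

_*_ : ℝ → ℝ → ℝ
x * y = mkℝ (λ n → seq x n ℚ.* seq y n) (*-cauchy (seq x) (seq y) (cauchy x) (cauchy y))

+-0-rawMonoid : RawMonoid 0ℓ 0ℓ
+-0-rawMonoid = record { _≈_ = _≃_ ; _∙_ = _+_ ; ε = 0ℝ }

open RawMonoidDefinitions +-0-rawMonoid public using (sum)
open RawMonoidDefinitions ℤ.+-0-rawMonoid public renaming (sum to sumℤ) using ()

------------------------------------------------------------------------
-- Points and convexity in ℝᵈ

Point : ℕ → Set
Point d = Vector ℝ d

LatticePoint : ℕ → Set
LatticePoint d = Vec ℤ d

infix 4 _≋_

_≋_ : ∀ {d} → Point d → Point d → Set
x ≋ y = ∀ i → x i ≃ y i

toPoint : ∀ {d} → LatticePoint d → Point d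
toPoint z i = fromℤ (lookup z i)

_·_ : ∀ {d} → Vector ℝ d → Vector ℝ d → ℝ
x · y = sum (λ i → x i * y i)

combination : ∀ {n d} → Vector ℝ n → Vector (Point d) n → Point d
combination w p j = sum (λ i → w i * p i j)

ConvexHull : ∀ {n d} → Vector (Point d) n → Pred (Point d) 0ℓ
ConvexHull p x = ∃ λ w → (∀ i → 0ℝ ≤ w i) × sum w ≃ 1ℝ × x ≋ combination w p

AffineHull : ∀ {d} → Pred (Point d) 0ℓ → Pred (Point d) 0ℓ
AffineHull A x = ∃ λ n → ∃ λ (p : Vector (Point _) n) → ∃ λ w →
  (∀ i → A (p i)) × sum w ≃ 1ℝ × x ≋ combination w p

Dilate : ∀ {d} → ℕ → Pred (Point d) 0ℓ → Pred (Point d) 0ℓ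
Dilate m A x = ∃ λ p → A p × (∀ i → x i ≃ fromℕ m * p i)

-- The topology on ℝᵈ is given by sup-norm balls of rational radius.
Interior : ∀ {d} → Pred (Point d) 0ℓ → Pred (Point d) 0ℓ
Interior A x = ∃ λ ε → 0ℚ ℚ.< ε ×
  (∀ y → (∀ i → y i ≤ x i + fromℚ ε × x i ≤ y i + fromℚ ε) → A y)

------------------------------------------------------------------------
-- Lattice polytopes

-- The points need not be in convex position: the vertices of the polytope
-- are among them, and every polytope is the convex hull of its vertices.
record LatticePolytope (d : ℕ) : Set where
  field
    size   : ℕ
    points : Vector (LatticePoint d) size

⟦_⟧ : ∀ {d} → LatticePolytope d → Pred (Point d) 0ℓ
⟦ P ⟧ = ConvexHull (λ i → toPoint (points i))
  where open LatticePolytope P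

FullDimensional : ∀ {d} → LatticePolytope d → Set
FullDimensional P = ∀ x → AffineHull ⟦ P ⟧ x

HasInteriorLatticePoint : ∀ {d} → LatticePolytope d → Set
HasInteriorLatticePoint P = ∃ λ z → Interior ⟦ P ⟧ (toPoint z)

-- |A ∩ ℤᵈ| = N
LatticePointCount : ∀ {d} → Pred (Point d) 0ℓ → ℕ → Set
LatticePointCount {d} A N = ∃ λ (zs : List (LatticePoint d)) →
  Unique zs × (∀ z → z ∈ zs ⇔ A (toPoint z)) × length zs ≡ N

IsEhrhartFunction : ∀ {d} → LatticePolytope d → (ℕ → ℕ) → Set
IsEhrhartFunction P f = ∀ m → LatticePointCount (Dilate m ⟦ P ⟧) (f m)

------------------------------------------------------------------------
-- h*-polynomials

PowerSeries : Set
PowerSeries = ℕ → ℤ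

infixl 7 _⊛_

_⊛_ : PowerSeries → PowerSeries → PowerSeries
(a ⊛ b) k = sumℤ {suc k} (λ i → a (toℕ i) ℤ.* b (k ℕ.∸ toℕ i))

polynomial : ∀ {n} → Vec ℤ n → PowerSeries
polynomial []       _       = + 0
polynomial (a ∷ as) zero    = a
polynomial (a ∷ as) (suc k) = polynomial as k

power : PowerSeries → ℕ → PowerSeries
power a zero    = polynomial (+ 1 ∷ [])
power a (suc n) = a ⊛ power a n

1-t : PowerSeries
1-t = polynomial (+ 1 ∷ ℤ.- (+ 1) ∷ [])

-- The defining identity Σ f(m)tᵐ = h*(t)/(1-t)ᵈ⁺¹, multiplied by the
-- invertible power series (1-t)ᵈ⁺¹.
IsHStar : ∀ {d} → LatticePolytope d → Vec ℤ (suc d) → Set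
IsHStar {d} P h = ∃ λ f → IsEhrhartFunction P f ×
  (∀ k → (power 1-t (suc d) ⊛ (λ m → + f m)) k ≡ polynomial h k)

-- (h*₁, …, h*_d), so that index i carries h*_{i+1}.
hVector : ∀ {d} → Vec ℤ (suc d) → Vector ℝ d
hVector h i = fromℤ (lookup h (suc i))

------------------------------------------------------------------------
-- Linear inequalities α · (h*₁, …, h*_d) ≥ 0

StrictlyBalancedInequality : (d : ℕ) → Vector ℝ d → Set
StrictlyBalancedInequality d α =
  sum α ≃ 0ℝ ×
  (∀ (P : LatticePolytope d) → FullDimensional P → HasInteriorLatticePoint P →
   ∀ h → IsHStar P h → 0ℝ ≤ α · hVector h)

DeducibleFrom : ∀ {d} → Pred (Vector ℝ d) 0ℓ → Vector ℝ d → Set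
DeducibleFrom system α = ∀ x → system x → 0ℝ ≤ α · x

InequalitySystem : Pred (Vector ℝ 6) 0ℓ
InequalitySystem x =
  (h₆ ≤ h₁ × h₁ ≤ h₅ × h₅ ≤ h₂) ×
  (h₁ + h₂ ≤ h₄ + h₅ × h₄ + h₅ ≤ h₂ + h₃) ×
  (h₁ + h₂ ≤ h₃ + h₄)
  where
  h₁ h₂ h₃ h₄ h₅ h₆ : ℝ
  h₁ = x 0F
  h₂ = x 1F
  h₃ = x 2F
  h₄ = x 3F
  h₅ = x 4F
  h₆ = x 5F

{-# OPTIONS --safe #-}
module Submission where

-- Modulo the lineality direction (1,…,1), the cone cut out by the inequalities has six
-- extremal rays (h₁,…,h₆):
--   (1,1,1,1,1,0), (0,0,1,0,0,0), (0,0,1,1,0,0), (0,1,0,1,0,0), (0,1,1,0,1,0), (0,2,1,1,2,0).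
-- Since Σ αᵢ = 0, it suffices that each ray is, up to adding a multiple of (1,…,1), the
-- h*-vector of a lattice polytope with an interior lattice point.  All six come from the
-- simplices conv(-q, e₁, …, e_d) with q ≥ 1, whose barycentric relation is
-- 0 = (-q + Σ qⱼ eⱼ) / N with N = 1 + Σ qⱼ.  The cone over such a simplex is a free module
-- over its vertices on N box points indexed by residues r < N, the box point of residue r
-- having height r - Σ ⌊qⱼ r / N⌋; hence h*ᵢ counts the residues of height i.

open import Defs using (PowerSeries; _⊛_; polynomial; power; 1-t; sumℤ)
open import Data.Vec.Functional using (Vector)

open import Level using (0ℓ)
open import Algebra.Bundles using (CommutativeRing; Semiring)
import Algebra.Properties.Semiring.Sum as Sum
import Algebra.Solver.Ring
import Algebra.Solver.Ring.AlmostCommutativeRing as ACR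
import Relation.Binary.Reasoning.Setoid
open import Data.Nat.Base as ℕ using (ℕ; zero; suc)
import Data.Nat.DivMod as ℕ
import Data.Nat.ListAction as ListAction
import Data.Nat.Properties as ℕ
open import Data.Integer.Base as ℤ using (ℤ; +_)
import Data.Integer.Properties as ℤ
open import Data.Integer.Tactic.RingSolver using (solve-∀)
open import Data.Rational.Base as ℚ using (ℚ; 0ℚ; 1ℚ; ½; fromℚᵘ; toℚᵘ)
import Data.Rational.Properties as ℚ
open import Data.Rational.Solver using (module +-*-Solver)
open import Data.Rational.Unnormalised.Base as ℚᵘ using (ℚᵘ; mkℚᵘ)
import Data.Rational.Unnormalised.Properties as ℚᵘ
open import Data.Fin.Base using (Fin; zero; suc; toℕ; _↑ˡ_; _↑ʳ_)
open import Data.Fin.Patterns using (0F; 1F; 2F; 3F; 4F; 5F)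
import Data.Fin.Properties as Fin
open import Data.Vec.Base as Vec using (Vec; []; _∷_; lookup; tabulate; replicate)
import Data.Vec.Properties as Vec
import Data.Vec.Functional as Vector
open import Data.List.Base as List using (List; []; _∷_; _++_; length; allFin; concatMap)
import Data.List.Properties as List
open import Data.List.Membership.Propositional using (_∈_)
open import Data.List.Membership.Propositional.Properties
  using (∈-map⁺; ∈-map⁻; ∈-++⁺ˡ; ∈-++⁺ʳ; ∈-++⁻; ∈-allFin; ∈-concatMap⁺; ∈-concatMap⁻)
open import Data.List.Relation.Binary.Disjoint.Propositional using (Disjoint)
open import Data.List.Relation.Unary.Any as Any using (here; satisfied)
import Data.List.Relation.Unary.All as All
import Data.List.Relation.Unary.All.Properties as All
import Data.List.Relation.Unary.AllPairs as AllPairs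
import Data.List.Relation.Unary.AllPairs.Properties as AllPairs
open import Data.List.Relation.Unary.Unique.Propositional using (Unique)
import Data.List.Relation.Unary.Unique.Propositional.Properties as Unique
open import Data.Maybe.Base as Maybe using (Maybe)
open import Data.Product.Base using (∃; _×_; _,_; proj₁; proj₂)
open import Data.Sum.Base using (_⊎_; inj₁; inj₂; [_,_]′)
open import Function.Base using (_∘_; id; case_of_)
open import Function.Bundles using (mk⇔)
open import Relation.Nullary.Decidable using (dec⇒maybe; from-yes)
open import Relation.Nullary.Negation using (¬_; contradiction)
open import Relation.Binary.PropositionalEquality
  using (_≡_; _≢_; _≗_; refl; sym; trans; cong; cong₂; subst; module ≡-Reasoning)

-- A box point at height h contributes t^h/(1-t)^(d+1) to the Ehrhart series, so h* comes out after
-- d+1 backward differences and no series has to be inverted. The order on Cauchy reals is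
-- undecidable, which is an obstacle twice. Counting the lattice points of mP needs an exact finite
-- list. But N times a barycentric coordinate of a lattice point is an integer, so membership
-- becomes a system of integer inequalities, and division by N with remainder turns each solution
-- into a residue and d+1 natural numbers. Moreover, the cone is not simplicial. Numbering the rays
-- r₀ to r₅ in the order listed, the only linear relation among them is r₁ + r₅ = r₂ + 2 r₄, so
-- coordinates with respect to the rays are not unique, and which choice is nonnegative depends on
-- the sign of a real number. That case split is admissible because its goal is a non-strict
-- inequality, and these are stable under double negation.

ℤ-semiring : Semiring 0ℓ 0ℓ
ℤ-semiring = CommutativeRing.semiring ℤ.+-*-commutativeRing

private
  module ℕ∑ = Sum ℕ.+-*-semiring
  module ℤ∑ = Sum ℤ-semiring

open ℕ∑ using () renaming (sum to sumℕ)

private variable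
  A : Set
  n : ℕ

i+j-j≡i : ∀ i j → i ℤ.+ j ℤ.- j ≡ i
i+j-j≡i = solve-∀

i-j+j≡i : ∀ i j → i ℤ.- j ℤ.+ j ≡ i
i-j+j≡i = solve-∀

-- Power series and weak compositions

Δ : PowerSeries → PowerSeries
Δ a zero    = a zero
Δ a (suc k) = a (suc k) ℤ.- a k

-- The innermost difference is taken first, to match the descent in `Δ^-totalCount`; `Δ-Δ^` moves it
-- outermost, where the recursion of `power` has it.
Δ^ : ℕ → PowerSeries → PowerSeries
Δ^ zero    a = a
Δ^ (suc n) a = Δ^ n (Δ a)

Δ-cong : ∀ {a b} → a ≗ b → Δ a ≗ Δ b
Δ-cong a≗b zero    = a≗b zero
Δ-cong a≗b (suc k) = cong₂ ℤ._-_ (a≗b (suc k)) (a≗b k)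

Δ^-cong : ∀ n {a b} → a ≗ b → Δ^ n a ≗ Δ^ n b
Δ^-cong zero    a≗b = a≗b
Δ^-cong (suc n) a≗b = Δ^-cong n (Δ-cong a≗b)

Δ-Δ^ : ∀ n a → Δ (Δ^ n a) ≡ Δ^ (suc n) a
Δ-Δ^ zero    a = refl
Δ-Δ^ (suc n) a = Δ-Δ^ n (Δ a)

⊛-congˡ : ∀ b {a a′} → a ≗ a′ → a ⊛ b ≗ a′ ⊛ b
⊛-congˡ b a≗a′ k = ℤ∑.sum-cong-≗ {suc k} λ i → cong (ℤ._* b (k ℕ.∸ toℕ i)) (a≗a′ (toℕ i))

1-t⊛ : ∀ a → 1-t ⊛ a ≗ Δ a
1-t⊛ a zero    = trans (ℤ.+-identityʳ _) (ℤ.*-identityˡ (a 0))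
1-t⊛ a (suc k) = begin
  + 1 ℤ.* a (suc k) ℤ.+ (ℤ.- + 1 ℤ.* a k ℤ.+ sumℤ {k} (λ _ → + 0))
    ≡⟨ cong (λ s → + 1 ℤ.* a (suc k) ℤ.+ (ℤ.- + 1 ℤ.* a k ℤ.+ s)) (ℤ∑.sum-replicate-zero k) ⟩
  + 1 ℤ.* a (suc k) ℤ.+ (ℤ.- + 1 ℤ.* a k ℤ.+ + 0)
    ≡⟨ identity (a (suc k)) (a k) ⟩
  a (suc k) ℤ.- a k ∎
  where
  open ≡-Reasoning
  identity : ∀ x y → + 1 ℤ.* x ℤ.+ (ℤ.- + 1 ℤ.* y ℤ.+ + 0) ≡ x ℤ.- y
  identity = solve-∀

1⊛ : ∀ a → polynomial (+ 1 ∷ []) ⊛ a ≗ a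
1⊛ a k = begin
  + 1 ℤ.* a k ℤ.+ sumℤ {k} (λ _ → + 0) ≡⟨ cong₂ ℤ._+_ (ℤ.*-identityˡ (a k)) (ℤ∑.sum-replicate-zero k) ⟩
  a k ℤ.+ + 0                          ≡⟨ ℤ.+-identityʳ (a k) ⟩
  a k                                  ∎
  where open ≡-Reasoning

sumℤ-Δ : ∀ {n} (x y b : Vector ℤ n) →
  sumℤ (λ i → (x i ℤ.- y i) ℤ.* b i) ≡ sumℤ (λ i → x i ℤ.* b i) ℤ.- sumℤ (λ i → y i ℤ.* b i)
sumℤ-Δ {zero}  x y b = refl
sumℤ-Δ {suc n} x y b = trans
  (cong (ℤ._+_ ((x zero ℤ.- y zero) ℤ.* b zero)) (sumℤ-Δ (x ∘ suc) (y ∘ suc) (b ∘ suc)))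
  (identity (x zero) (y zero) (b zero) _ _)
  where
  identity : ∀ x y b s t →
    (x ℤ.- y) ℤ.* b ℤ.+ (s ℤ.- t) ≡ (x ℤ.* b ℤ.+ s) ℤ.- (y ℤ.* b ℤ.+ t)
  identity = solve-∀

-- This is the instance ((1-t)a)b = (1-t)(ab) of associativity, the only one that `power-1-t⊛`
-- requires.
Δ-⊛ : ∀ a b → Δ a ⊛ b ≗ Δ (a ⊛ b)
Δ-⊛ a b zero    = refl
Δ-⊛ a b (suc k) = trans
  (cong (ℤ._+_ (a 0 ℤ.* b (suc k)))
    (sumℤ-Δ {suc k} (a ∘ suc ∘ toℕ) (a ∘ toℕ) (λ i → b (k ℕ.∸ toℕ i))))
  (sym (ℤ.+-assoc (a 0 ℤ.* b (suc k)) _ _))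

power-1-t⊛ : ∀ n a → power 1-t n ⊛ a ≗ Δ^ n a
power-1-t⊛ zero    a k = 1⊛ a k
power-1-t⊛ (suc n) a k = begin
  ((1-t ⊛ power 1-t n) ⊛ a) k ≡⟨ ⊛-congˡ a (1-t⊛ (power 1-t n)) k ⟩
  (Δ (power 1-t n) ⊛ a) k     ≡⟨ Δ-⊛ (power 1-t n) a k ⟩
  Δ (power 1-t n ⊛ a) k       ≡⟨ Δ-cong (power-1-t⊛ n a) k ⟩
  Δ (Δ^ n a) k                ≡⟨ cong (λ s → s k) (Δ-Δ^ n a) ⟩
  Δ^ (suc n) a k              ∎
  where open ≡-Reasoning

incrementHead : Vec ℕ (suc n) → Vec ℕ (suc n)
incrementHead (x ∷ xs) = suc x ∷ xs

-- Splitting on whether the first part is zero mirrors 1/(1-t)^(n+1) = 1/(1-t)^n + t/(1-t)^(n+1), so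
-- that a backward difference of the counts lowers n by one.
compositions : ∀ n → ℕ → List (Vec ℕ n)
compositions zero    zero    = [] ∷ []
compositions zero    (suc k) = []
compositions (suc n) zero    = List.map (0 ∷_) (compositions n zero)
compositions (suc n) (suc k) =
  List.map (0 ∷_) (compositions n (suc k)) ++ List.map incrementHead (compositions (suc n) k)

-- On generating functions of lengths this is multiplication by t^h.
delay : ℕ → (ℕ → List A) → ℕ → List A
delay zero    f m       = f m
delay (suc h) f zero    = []
delay (suc h) f (suc m) = delay h f m

delayedCount : ℕ → ℕ → ℕ → ℕ
delayedCount n h m = length (delay h (compositions n) m)

-- The coefficient of t^m in the sum of t^h/(1-t)^n over `hs`. At n = 0 it is the number of entries
-- of `hs` equal to m, which is how h* is read off.
totalCount : ℕ → List ℕ → ℕ → ℕ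
totalCount n hs m = ListAction.sum (List.map (λ h → delayedCount n h m) hs)

delayedCount-zero : ∀ n h → delayedCount (suc n) h 0 ≡ delayedCount n h 0
delayedCount-zero n zero    = List.length-map (0 ∷_) (compositions n 0)
delayedCount-zero n (suc h) = refl

delayedCount-suc : ∀ n h m →
  delayedCount (suc n) h (suc m) ≡ delayedCount n h (suc m) ℕ.+ delayedCount (suc n) h m
delayedCount-suc n zero m = trans
  (List.length-++ (List.map (0 ∷_) (compositions n (suc m))))
  (cong₂ ℕ._+_ (List.length-map _ (compositions n (suc m)))
               (List.length-map _ (compositions (suc n) m)))
delayedCount-suc n (suc zero)    zero    = trans (delayedCount-zero n 0) (sym (ℕ.+-identityʳ _))
delayedCount-suc n (suc (suc h)) zero    = refl
delayedCount-suc n (suc h)       (suc m) = delayedCount-suc n h m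

totalCount-zero : ∀ n hs → totalCount (suc n) hs 0 ≡ totalCount n hs 0
totalCount-zero n hs = cong ListAction.sum (List.map-cong (delayedCount-zero n) hs)

totalCount-suc : ∀ n hs m →
  totalCount (suc n) hs (suc m) ≡ totalCount n hs (suc m) ℕ.+ totalCount (suc n) hs m
totalCount-suc n []       m = refl
totalCount-suc n (h ∷ hs) m = trans
  (cong₂ ℕ._+_ (delayedCount-suc n h m) (totalCount-suc n hs m))
  (interchange (delayedCount n h (suc m)) _ _ _)
  where open import Algebra.Properties.CommutativeSemigroup ℕ.+-commutativeSemigroup using (interchange)

Δ-totalCount : ∀ n hs → Δ (+_ ∘ totalCount (suc n) hs) ≗ +_ ∘ totalCount n hs
Δ-totalCount n hs zero    = cong +_ (totalCount-zero n hs)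
Δ-totalCount n hs (suc m) = trans
  (cong (λ s → + s ℤ.- + totalCount (suc n) hs m) (totalCount-suc n hs m))
  (i+j-j≡i (+ totalCount n hs (suc m)) (+ totalCount (suc n) hs m))

Δ^-totalCount : ∀ n hs → Δ^ n (+_ ∘ totalCount n hs) ≗ +_ ∘ totalCount 0 hs
Δ^-totalCount zero    hs k = refl
Δ^-totalCount (suc n) hs k = trans
  (Δ^-cong n (Δ-totalCount n hs) k) (Δ^-totalCount n hs k)

polynomial-tabulate : ∀ n (a : PowerSeries) → (∀ k → a (n ℕ.+ k) ≡ + 0) →
  ∀ k → a k ≡ polynomial (tabulate {n = n} (a ∘ toℕ)) k
polynomial-tabulate zero    a vanishes k       = vanishes k
polynomial-tabulate (suc n) a vanishes zero    = refl
polynomial-tabulate (suc n) a vanishes (suc k) = polynomial-tabulate n (a ∘ suc) vanishes k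

∈-compositions⁻ : ∀ n k {v} → v ∈ compositions n k → sumℕ (lookup v) ≡ k
∈-compositions⁻ zero    zero    (here refl) = refl
∈-compositions⁻ (suc n) zero    v∈ with _ , w∈ , refl ← ∈-map⁻ (0 ∷_) v∈ = ∈-compositions⁻ n zero w∈
∈-compositions⁻ (suc n) (suc k) v∈ with ∈-++⁻ (List.map (0 ∷_) (compositions n (suc k))) v∈
... | inj₁ v∈₀ with _ , w∈ , refl ← ∈-map⁻ (0 ∷_) v∈₀ = ∈-compositions⁻ n (suc k) w∈
... | inj₂ v∈₊ with (_ ∷ _) , w∈ , refl ← ∈-map⁻ incrementHead v∈₊ =
  cong suc (∈-compositions⁻ (suc n) k w∈)

∈-compositions⁺ : (v : Vec ℕ n) → v ∈ compositions n (sumℕ (lookup v))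
∈-compositions⁺ []           = here refl
∈-compositions⁺ (zero  ∷ v) with sumℕ (lookup v) | ∈-compositions⁺ v
... | zero  | v∈ = ∈-map⁺ (0 ∷_) v∈
... | suc k | v∈ = ∈-++⁺ˡ (∈-map⁺ (0 ∷_) v∈)
∈-compositions⁺ (suc x ∷ v) =
  ∈-++⁺ʳ (List.map (0 ∷_) (compositions _ _)) (∈-map⁺ incrementHead (∈-compositions⁺ (x ∷ v)))

compositions-unique : ∀ n k → Unique (compositions n k)
compositions-unique zero    zero    = All.[] AllPairs.∷ AllPairs.[]
compositions-unique zero    (suc k) = AllPairs.[]
compositions-unique (suc n) zero    = Unique.map⁺ Vec.∷-injectiveʳ (compositions-unique n zero)
compositions-unique (suc n) (suc k) = Unique.++⁺
  (Unique.map⁺ Vec.∷-injectiveʳ (compositions-unique n (suc k)))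
  (Unique.map⁺ incrementHead-injective (compositions-unique (suc n) k))
  disjoint
  where
  incrementHead-injective : ∀ {v w : Vec ℕ (suc n)} → incrementHead v ≡ incrementHead w → v ≡ w
  incrementHead-injective {_ ∷ _} {_ ∷ _} refl = refl
  disjoint : ∀ {v} → v ∈ List.map (0 ∷_) (compositions n (suc k)) ×
                     v ∈ List.map incrementHead (compositions (suc n) k) → _
  disjoint (v∈₀ , v∈₊) with _ , _ , refl ← ∈-map⁻ (0 ∷_) v∈₀ with ∈-map⁻ incrementHead v∈₊
  ... | (_ ∷ _) , _ , ()

∈-delay⁻ : ∀ h (f : ℕ → List A) m {x} → x ∈ delay h f m → ∃ λ k → x ∈ f k × h ℕ.+ k ≡ m
∈-delay⁻ zero    f m       x∈ = m , x∈ , refl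
∈-delay⁻ (suc h) f (suc m) x∈ with k , x∈f , refl ← ∈-delay⁻ h f m x∈ = k , x∈f , refl

∈-delay⁺ : ∀ h (f : ℕ → List A) k {x} → x ∈ f k → x ∈ delay h f (h ℕ.+ k)
∈-delay⁺ zero    f k x∈ = x∈
∈-delay⁺ (suc h) f k x∈ = ∈-delay⁺ h f k x∈

delay-unique : ∀ h {f : ℕ → List A} → (∀ k → Unique (f k)) → ∀ m → Unique (delay h f m)
delay-unique zero    u m       = u m
delay-unique (suc h) u zero    = AllPairs.[]
delay-unique (suc h) u (suc m) = delay-unique h u m

+-sumℕ : ∀ {n} (f : Vector ℕ n) → + sumℕ f ≡ sumℤ (+_ ∘ f)
+-sumℕ {zero}  f = refl
+-sumℕ {suc n} f = trans (ℤ.pos-+ (f zero) _) (cong (ℤ._+_ (+ f zero)) (+-sumℕ (f ∘ suc)))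

sumℕ-mono-≤ : ∀ {n} {f g : Vector ℕ n} → (∀ i → f i ℕ.≤ g i) → sumℕ f ℕ.≤ sumℕ g
sumℕ-mono-≤ {zero}  f≤g = ℕ.z≤n
sumℕ-mono-≤ {suc n} f≤g = ℕ.+-mono-≤ (f≤g zero) (sumℕ-mono-≤ (f≤g ∘ suc))

-- A negative i would give v i + e ≤ e - v < 0. Applied to `slack-identity`, this makes the integer
-- part of a nonnegative barycentric coordinate nonnegative.
0≤v*i+e⇒0≤i : ∀ v i e → e ℕ.< v → + 0 ℤ.≤ + v ℤ.* i ℤ.+ + e → + 0 ℤ.≤ i
0≤v*i+e⇒0≤i v (+ n)        e e<v h = ℤ.+≤+ ℕ.z≤n
0≤v*i+e⇒0≤i v ℤ.-[1+ n ] e e<v h = contradiction h (ℤ.<⇒≱ (begin-strict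
  + v ℤ.* ℤ.-[1+ n ] ℤ.+ + e   ≤⟨ ℤ.+-monoˡ-≤ (+ e) (ℤ.*-monoˡ-≤-nonNeg (+ v) (ℤ.-≤- (ℕ.z≤n {n}))) ⟩
  + v ℤ.* ℤ.-1ℤ ℤ.+ + e        <⟨ ℤ.+-monoʳ-< (+ v ℤ.* ℤ.-1ℤ) (ℤ.+<+ e<v) ⟩
  + v ℤ.* ℤ.-1ℤ ℤ.+ + v        ≡⟨ identity (+ v) ⟩
  + 0                          ∎))
  where
  open ℤ.≤-Reasoning
  identity : ∀ v → v ℤ.* ℤ.-1ℤ ℤ.+ v ≡ + 0
  identity = solve-∀

-- Lattice points of the cone over the simplex conv(-q, e₁, …, e_d)

module _ {d : ℕ} (q : Vector ℕ d) where

  volume : ℕ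
  volume = suc (sumℕ q)

  ⌊_⌋ : ℕ → Vector ℕ d
  ⌊ r ⌋ j = q j ℕ.* r ℕ./ volume

  -- The box point of residue r has barycentric coordinates r/N and the fractional parts of qⱼ r/N.
  -- Since r (1 + Σ qⱼ)/N = r, they add up to r - Σ ⌊qⱼ r/N⌋; `sum-⌊⌋≤` shows that the truncated
  -- subtraction is exact.
  height : ℕ → ℕ
  height r = r ℕ.∸ sumℕ ⌊ r ⌋

  sum-⌊⌋≤ : ∀ r → sumℕ ⌊ r ⌋ ℕ.≤ r
  sum-⌊⌋≤ r = ℕ.*-cancelʳ-≤ (sumℕ ⌊ r ⌋) r volume (begin
    sumℕ ⌊ r ⌋ ℕ.* volume            ≡⟨ ℕ∑.*-distribʳ-sum volume ⌊ r ⌋ ⟩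
    sumℕ (λ j → ⌊ r ⌋ j ℕ.* volume)  ≤⟨ sumℕ-mono-≤ (λ j → ℕ.m/n*n≤m (q j ℕ.* r) volume) ⟩
    sumℕ (λ j → q j ℕ.* r)           ≡⟨ ℕ∑.*-distribʳ-sum r q ⟨
    sumℕ q ℕ.* r                     ≤⟨ ℕ.*-monoˡ-≤ r (ℕ.n≤1+n (sumℕ q)) ⟩
    volume ℕ.* r                     ≡⟨ ℕ.*-comm volume r ⟩
    r ℕ.* volume                     ∎)
    where open ℕ.≤-Reasoning

  -- If z = λ₀ (-q) + Σ λⱼ eⱼ with λ₀ + Σ λⱼ = m, then slack₀ m z = volume · λ₀ and
  -- slack m z j = volume · λⱼ.
  slack₀ : ℕ → Vec ℤ d → ℤ
  slack₀ m z = + m ℤ.- sumℤ (lookup z)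

  slack : ℕ → Vec ℤ d → Vector ℤ d
  slack m z j = + volume ℤ.* lookup z j ℤ.+ + q j ℤ.* slack₀ m z

  InCone : ℕ → Vec ℤ d → Set
  InCone m z = + 0 ℤ.≤ slack₀ m z × (∀ j → + 0 ℤ.≤ slack m z j)

  -- (r , k ∷ y) stands for the box point of residue r plus k (-q) plus Σ yⱼ eⱼ.
  Code : Set
  Code = Fin volume × Vec ℕ (suc d)

  residueCodes : ℕ → Fin volume → List Code
  residueCodes m r = List.map (r ,_) (delay (height (toℕ r)) (compositions (suc d)) m)

  codes : ℕ → List Code
  codes m = concatMap (residueCodes m) (allFin volume)

  degree : Code → ℕ
  degree (r , v) = height (toℕ r) ℕ.+ sumℕ (lookup v)

  ∈-codes⁻ : ∀ m {c} → c ∈ codes m → degree c ≡ m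
  ∈-codes⁻ m {c} c∈ with r , c∈r ← satisfied (∈-concatMap⁻ (residueCodes m) {xs = allFin volume} c∈)
    with v , v∈ , refl ← ∈-map⁻ (r ,_) c∈r
    with k , v∈k , eq ← ∈-delay⁻ (height (toℕ r)) _ m v∈ =
    trans (cong (height (toℕ r) ℕ.+_) (∈-compositions⁻ (suc d) k v∈k)) eq

  ∈-codes⁺ : ∀ c → c ∈ codes (degree c)
  ∈-codes⁺ (r , v) = ∈-concatMap⁺ (residueCodes (degree (r , v))) (Any.map (λ { refl → ∈-map⁺ (r ,_)
    (∈-delay⁺ (height (toℕ r)) _ (sumℕ (lookup v)) (∈-compositions⁺ v)) }) (∈-allFin r))

  codes-unique : ∀ m → Unique (codes m)
  codes-unique m = Unique.concat⁺
    (All.map⁺ (All.tabulate λ {r} _ → Unique.map⁺ (cong proj₂)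
      (delay-unique (height (toℕ r)) (compositions-unique (suc d)) m)))
    (AllPairs.map⁺ (AllPairs.map disjoint (Unique.allFin⁺ volume)))
    where
    disjoint : ∀ {r s} → r ≢ s → Disjoint (residueCodes m r) (residueCodes m s)
    disjoint {r} {s} r≢s (c∈r , c∈s)
      with _ , _ , refl ← ∈-map⁻ (r ,_) c∈r with _ , _ , refl ← ∈-map⁻ (s ,_) c∈s = r≢s refl

  length-codes : ∀ m → length (codes m) ≡
    totalCount (suc d) (List.map (height ∘ toℕ) (allFin volume)) m
  length-codes m = go (allFin volume)
    where
    go : ∀ rs → length (concatMap (residueCodes m) rs)
       ≡ totalCount (suc d) (List.map (height ∘ toℕ) rs) m
    go []       = refl
    go (r ∷ rs) = trans (List.length-++ (residueCodes m r))
      (cong₂ ℕ._+_ (List.length-map (r ,_) (delay (height (toℕ r)) (compositions (suc d)) m)) (go rs))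

  -- The box point of residue r has j-th coordinate -qⱼ r/N plus the fractional part of qⱼ r/N,
  -- which is -⌊qⱼ r/N⌋.
  decode : Code → Vec ℤ d
  decode (r , k ∷ y) = tabulate λ j → + lookup y j ℤ.- (+ q j ℤ.* + k ℤ.+ + ⌊ toℕ r ⌋ j)

  shift : ℕ → ℕ → Vec ℤ d → Vector ℤ d
  shift r k z j = lookup z j ℤ.+ (+ q j ℤ.* + k ℤ.+ + ⌊ r ⌋ j)

  encodeWith : Fin volume → ℕ → Vec ℤ d → Code
  encodeWith r k z = r , k ∷ tabulate λ j → ℤ.∣ shift (toℕ r) k z j ∣

  -- In the cone `slack₀` is r + kN with r < N, so r and k are its remainder and quotient by N. The
  -- absolute values only make the map total: on the cone their arguments are nonnegative.
  encode : ℕ → Vec ℤ d → Code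
  encode m z = encodeWith (S ℕ.mod volume) (S ℕ./ volume) z
    where
    S : ℕ
    S = ℤ.∣ slack₀ m z ∣

  +-height : ∀ r → + height r ≡ + r ℤ.- sumℤ (+_ ∘ ⌊ r ⌋)
  +-height r = begin
    + height r                  ≡⟨ ℤ.⊖-≥ (sum-⌊⌋≤ r) ⟨
    r ℤ.⊖ sumℕ ⌊ r ⌋            ≡⟨ ℤ.m-n≡m⊖n r (sumℕ ⌊ r ⌋) ⟨
    + r ℤ.- + sumℕ ⌊ r ⌋        ≡⟨ cong (ℤ._-_ (+ r)) (+-sumℕ ⌊ r ⌋) ⟩
    + r ℤ.- sumℤ (+_ ∘ ⌊ r ⌋)   ∎
    where open ≡-Reasoning

  sum-shift : ∀ (z : Vector ℤ d) k r → sumℤ (λ j → z j ℤ.+ (+ q j ℤ.* k ℤ.+ + ⌊ r ⌋ j))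
            ≡ sumℤ z ℤ.+ ((+ volume ℤ.- + 1) ℤ.* k ℤ.+ (+ r ℤ.- + height r))
  sum-shift z k r = begin
    sumℤ (λ j → z j ℤ.+ (+ q j ℤ.* k ℤ.+ + ⌊ r ⌋ j))
      ≡⟨ ℤ∑.∑-distrib-+ z _ ⟩
    sumℤ z ℤ.+ sumℤ (λ j → + q j ℤ.* k ℤ.+ + ⌊ r ⌋ j)
      ≡⟨ cong (ℤ._+_ (sumℤ z)) (ℤ∑.∑-distrib-+ (λ j → + q j ℤ.* k) _) ⟩
    sumℤ z ℤ.+ (sumℤ (λ j → + q j ℤ.* k) ℤ.+ sumℤ (+_ ∘ ⌊ r ⌋))
      ≡⟨ cong (λ s → sumℤ z ℤ.+ (s ℤ.+ sumℤ (+_ ∘ ⌊ r ⌋))) (trans (sym (ℤ∑.*-distribʳ-sum k (+_ ∘ q))) (cong (ℤ._* k) (sym (+-sumℕ q)))) ⟩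
    sumℤ z ℤ.+ (+ sumℕ q ℤ.* k ℤ.+ sumℤ (+_ ∘ ⌊ r ⌋))
      ≡⟨ identity (sumℤ z) (+ sumℕ q) k (+ r) (sumℤ (+_ ∘ ⌊ r ⌋)) ⟩
    sumℤ z ℤ.+ ((+ volume ℤ.- + 1) ℤ.* k ℤ.+ (+ r ℤ.- (+ r ℤ.- sumℤ (+_ ∘ ⌊ r ⌋))))
      ≡⟨ cong (λ h → sumℤ z ℤ.+ ((+ volume ℤ.- + 1) ℤ.* k ℤ.+ (+ r ℤ.- h))) (+-height r) ⟨
    sumℤ z ℤ.+ ((+ volume ℤ.- + 1) ℤ.* k ℤ.+ (+ r ℤ.- + height r)) ∎
    where
    open ≡-Reasoning
    identity : ∀ z q k r f → z ℤ.+ (q ℤ.* k ℤ.+ f)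
      ≡ z ℤ.+ ((+ 1 ℤ.+ q ℤ.- + 1) ℤ.* k ℤ.+ (r ℤ.- (r ℤ.- f)))
    identity = solve-∀

  -- When y is the shift of z, the left side is `slack₀` of z at the level `degree (r , k ∷ y)`.
  -- Both directions of the bijection between codes and lattice points rest on this identity.
  level-identity : ∀ r k z →
    + height r ℤ.+ (+ k ℤ.+ sumℤ (shift r k z)) ℤ.- sumℤ (lookup z) ≡ + (r ℕ.+ k ℕ.* volume)
  level-identity r k z = begin
    + height r ℤ.+ (+ k ℤ.+ sumℤ (shift r k z)) ℤ.- sumℤ (lookup z)
      ≡⟨ cong (λ s → + height r ℤ.+ (+ k ℤ.+ s) ℤ.- sumℤ (lookup z)) (sum-shift (lookup z) (+ k) r) ⟩
    + height r ℤ.+ (+ k ℤ.+ (sumℤ (lookup z) ℤ.+ ((+ volume ℤ.- + 1) ℤ.* + k ℤ.+ (+ r ℤ.- + height r)))) ℤ.- sumℤ (lookup z)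
      ≡⟨ identity (+ height r) (+ k) (sumℤ (lookup z)) (+ volume) (+ r) ⟩
    + r ℤ.+ + k ℤ.* + volume
      ≡⟨ cong (ℤ._+_ (+ r)) (ℤ.pos-* k volume) ⟨
    + (r ℕ.+ k ℕ.* volume) ∎
    where
    open ≡-Reasoning
    identity : ∀ h k z v r → h ℤ.+ (k ℤ.+ (z ℤ.+ ((v ℤ.- + 1) ℤ.* k ℤ.+ (r ℤ.- h)))) ℤ.- z ≡ r ℤ.+ k ℤ.* v
    identity = solve-∀

  -- Divided by N, this splits the barycentric coordinate λⱼ into its integer part, the multiplicity
  -- yⱼ of the vertex eⱼ, and its fractional part, the share of the box point.
  slack-identity : ∀ r k m z → slack₀ m z ≡ + (r ℕ.+ k ℕ.* volume) → ∀ j →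
    slack m z j ≡ + volume ℤ.* shift r k z j ℤ.+ + (q j ℕ.* r ℕ.% volume)
  slack-identity r k m z eq j = begin
    + volume ℤ.* lookup z j ℤ.+ + q j ℤ.* slack₀ m z
      ≡⟨ cong (λ s → + volume ℤ.* lookup z j ℤ.+ + q j ℤ.* s) (trans eq (cong (ℤ._+_ (+ r)) (ℤ.pos-* k volume))) ⟩
    + volume ℤ.* lookup z j ℤ.+ + q j ℤ.* (+ r ℤ.+ + k ℤ.* + volume)
      ≡⟨ identity₁ (+ volume) (lookup z j) (+ q j) (+ r) (+ k) ⟩
    + volume ℤ.* lookup z j ℤ.+ + q j ℤ.* + k ℤ.* + volume ℤ.+ + q j ℤ.* + r
      ≡⟨ cong (ℤ._+_ (+ volume ℤ.* lookup z j ℤ.+ + q j ℤ.* + k ℤ.* + volume)) division ⟩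
    + volume ℤ.* lookup z j ℤ.+ + q j ℤ.* + k ℤ.* + volume
      ℤ.+ (+ (q j ℕ.* r ℕ.% volume) ℤ.+ + ⌊ r ⌋ j ℤ.* + volume)
      ≡⟨ identity₂ (+ volume) (lookup z j) (+ q j) (+ k) (+ (q j ℕ.* r ℕ.% volume)) (+ ⌊ r ⌋ j) ⟩
    + volume ℤ.* shift r k z j ℤ.+ + (q j ℕ.* r ℕ.% volume) ∎
    where
    open ≡-Reasoning
    identity₁ : ∀ v z q r k → v ℤ.* z ℤ.+ q ℤ.* (r ℤ.+ k ℤ.* v) ≡ v ℤ.* z ℤ.+ q ℤ.* k ℤ.* v ℤ.+ q ℤ.* r
    identity₁ = solve-∀
    identity₂ : ∀ v z q k e f →
      v ℤ.* z ℤ.+ q ℤ.* k ℤ.* v ℤ.+ (e ℤ.+ f ℤ.* v) ≡ v ℤ.* (z ℤ.+ (q ℤ.* k ℤ.+ f)) ℤ.+ e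
    identity₂ = solve-∀
    division : + q j ℤ.* + r ≡ + (q j ℕ.* r ℕ.% volume) ℤ.+ + ⌊ r ⌋ j ℤ.* + volume
    division = begin
      + q j ℤ.* + r      ≡⟨ ℤ.pos-* (q j) r ⟨
      + (q j ℕ.* r)      ≡⟨ cong +_ (ℕ.m≡m%n+[m/n]*n (q j ℕ.* r) volume) ⟩
      + (q j ℕ.* r ℕ.% volume) ℤ.+ + (⌊ r ⌋ j ℕ.* volume)
                         ≡⟨ cong (ℤ._+_ (+ (q j ℕ.* r ℕ.% volume))) (ℤ.pos-* (⌊ r ⌋ j) volume) ⟩
      + (q j ℕ.* r ℕ.% volume) ℤ.+ + ⌊ r ⌋ j ℤ.* + volume ∎

  shift-decode : ∀ r k y j → shift (toℕ r) k (decode (r , k ∷ y)) j ≡ + lookup y j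
  shift-decode r k y j = trans
    (cong (ℤ._+ (+ q j ℤ.* + k ℤ.+ + ⌊ toℕ r ⌋ j)) (Vec.lookup∘tabulate _ j))
    (i-j+j≡i (+ lookup y j) (+ q j ℤ.* + k ℤ.+ + ⌊ toℕ r ⌋ j))

  slack₀-decode : ∀ r k y → slack₀ (degree (r , k ∷ y)) (decode (r , k ∷ y)) ≡ + (toℕ r ℕ.+ k ℕ.* volume)
  slack₀-decode r k y = trans
    (cong (λ s → + height (toℕ r) ℤ.+ (+ k ℤ.+ s) ℤ.- sumℤ (lookup (decode (r , k ∷ y))))
      (trans (+-sumℕ (lookup y)) (ℤ∑.sum-cong-≗ (sym ∘ shift-decode r k y))))
    (level-identity (toℕ r) k (decode (r , k ∷ y)))

  decode-InCone : ∀ c → InCone (degree c) (decode c)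
  decode-InCone c@(r , k ∷ y) =
      subst (ℤ._≤_ (+ 0)) (sym (slack₀-decode r k y)) (ℤ.+≤+ ℕ.z≤n)
    , λ j → subst (ℤ._≤_ (+ 0)) (sym (trans
        (slack-identity (toℕ r) k (degree c) (decode c) (slack₀-decode r k y) j)
        (trans (cong (λ s → + volume ℤ.* s ℤ.+ + (q j ℕ.* toℕ r ℕ.% volume)) (shift-decode r k y j))
               (cong (ℤ._+ + (q j ℕ.* toℕ r ℕ.% volume)) (sym (ℤ.pos-* volume (lookup y j)))))))
        (ℤ.+≤+ ℕ.z≤n)

  module _ (m : ℕ) (z : Vec ℤ d) (z∈ : InCone m z) where
    private
      S : ℕ
      S = ℤ.∣ slack₀ m z ∣
      r : Fin volume
      r = S ℕ.mod volume
      k : ℕ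
      k = S ℕ./ volume
      y : Vec ℕ d
      y = tabulate λ j → ℤ.∣ shift (toℕ r) k z j ∣

      slack₀≡ : slack₀ m z ≡ + (toℕ r ℕ.+ k ℕ.* volume)
      slack₀≡ = trans (sym (ℤ.0≤i⇒+∣i∣≡i (proj₁ z∈))) (cong +_ (trans
        (ℕ.m≡m%n+[m/n]*n S volume)
        (cong (ℕ._+ k ℕ.* volume) (sym (Fin.toℕ-fromℕ< (ℕ.m%n<n S volume))))))

      y≡shift : ∀ j → + lookup y j ≡ shift (toℕ r) k z j
      y≡shift j = trans (cong +_ (Vec.lookup∘tabulate _ j)) (ℤ.0≤i⇒+∣i∣≡i
        (0≤v*i+e⇒0≤i volume _ (q j ℕ.* toℕ r ℕ.% volume) (ℕ.m%n<n (q j ℕ.* toℕ r) volume)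
          (subst (ℤ._≤_ (+ 0)) (slack-identity (toℕ r) k m z slack₀≡ j) (proj₂ z∈ j))))

    decode-encode : decode (encode m z) ≡ z
    decode-encode = trans (Vec.tabulate-cong λ j → trans
        (cong (ℤ._- (+ q j ℤ.* + k ℤ.+ + ⌊ toℕ r ⌋ j)) (y≡shift j))
        (i+j-j≡i (lookup z j) (+ q j ℤ.* + k ℤ.+ + ⌊ toℕ r ⌋ j)))
      (Vec.tabulate∘lookup z)

    degree-encode : degree (encode m z) ≡ m
    degree-encode = ℤ.+-injective (begin
      + (height (toℕ r) ℕ.+ (k ℕ.+ sumℕ (lookup y)))
        ≡⟨ cong (λ s → + height (toℕ r) ℤ.+ (+ k ℤ.+ s)) (trans (+-sumℕ (lookup y)) (ℤ∑.sum-cong-≗ y≡shift)) ⟩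
      + height (toℕ r) ℤ.+ (+ k ℤ.+ sumℤ (shift (toℕ r) k z))
        ≡⟨ i-j+j≡i _ (sumℤ (lookup z)) ⟨
      (+ height (toℕ r) ℤ.+ (+ k ℤ.+ sumℤ (shift (toℕ r) k z)) ℤ.- sumℤ (lookup z)) ℤ.+ sumℤ (lookup z)
        ≡⟨ cong (ℤ._+ sumℤ (lookup z)) (trans (level-identity (toℕ r) k z) (sym slack₀≡)) ⟩
      + m ℤ.- sumℤ (lookup z) ℤ.+ sumℤ (lookup z)
        ≡⟨ i-j+j≡i (+ m) (sumℤ (lookup z)) ⟩
      + m ∎)
      where open ≡-Reasoning

  [r+kn]mod : ∀ (r : Fin volume) k → (toℕ r ℕ.+ k ℕ.* volume) ℕ.mod volume ≡ r
  [r+kn]mod r k = Fin.toℕ-injective (trans (Fin.toℕ-fromℕ< _)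
    (trans (ℕ.[m+kn]%n≡m%n (toℕ r) k volume) (ℕ.m<n⇒m%n≡m (Fin.toℕ<n r))))

  [r+kn]/n : ∀ (r : Fin volume) k → (toℕ r ℕ.+ k ℕ.* volume) ℕ./ volume ≡ k
  [r+kn]/n r k = sym (ℕ.*-cancelʳ-≡ k _ volume (ℕ.+-cancelˡ-≡ (toℕ r) _ _ (trans
    (ℕ.m≡m%n+[m/n]*n (toℕ r ℕ.+ k ℕ.* volume) volume)
    (cong (ℕ._+ (toℕ r ℕ.+ k ℕ.* volume) ℕ./ volume ℕ.* volume)
      (trans (ℕ.[m+kn]%n≡m%n (toℕ r) k volume) (ℕ.m<n⇒m%n≡m (Fin.toℕ<n r)))))))

  encode-decode : ∀ c → encode (degree c) (decode c) ≡ c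
  encode-decode c@(r , k ∷ y) = begin
    encode (degree c) (decode c)
      ≡⟨ cong (λ s → encodeWith (ℤ.∣ s ∣ ℕ.mod volume) (ℤ.∣ s ∣ ℕ./ volume) (decode c)) (slack₀-decode r k y) ⟩
    encodeWith ((toℕ r ℕ.+ k ℕ.* volume) ℕ.mod volume) ((toℕ r ℕ.+ k ℕ.* volume) ℕ./ volume) (decode c)
      ≡⟨ cong₂ (λ r k → encodeWith r k (decode c)) ([r+kn]mod r k) ([r+kn]/n r k) ⟩
    encodeWith r k (decode c)
      ≡⟨ cong (λ y → r , k ∷ y) (trans
           (Vec.tabulate-cong (λ j → cong ℤ.∣_∣ (shift-decode r k y j))) (Vec.tabulate∘lookup y)) ⟩
    c ∎
    where open ≡-Reasoning

  conePoints : ℕ → List (Vec ℤ d)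
  conePoints m = List.map decode (codes m)

  ∈-conePoints⁻ : ∀ m {z} → z ∈ conePoints m → InCone m z
  ∈-conePoints⁻ m z∈ with c , c∈ , refl ← ∈-map⁻ decode z∈ with refl ← ∈-codes⁻ m c∈ = decode-InCone c

  ∈-conePoints⁺ : ∀ m {z} → InCone m z → z ∈ conePoints m
  ∈-conePoints⁺ m {z} z∈ = subst (_∈ conePoints m) (decode-encode m z z∈)
    (∈-map⁺ decode (subst (λ n → encode m z ∈ codes n) (degree-encode m z z∈) (∈-codes⁺ (encode m z))))

  -- Mapping `encode m` over the list gives back `codes m`, which is free of repetitions; a repeated
  -- point would give a repeated code.
  conePoints-unique : ∀ m → Unique (conePoints m)
  conePoints-unique m = Unique.map⁻ {f = encode m} (subst Unique (sym round-trip) (codes-unique m))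
    where
    round-trip : List.map (encode m) (conePoints m) ≡ codes m
    round-trip = trans (sym (List.map-∘ (codes m))) (List.map-id-local (All.tabulate λ {c} c∈ →
      trans (cong (λ n → encode n (decode c)) (sym (∈-codes⁻ m c∈))) (encode-decode c)))

-- Barycentric coordinates over an ordered ring

kroneckerδ : ∀ {n} → Fin n → Fin n → ℤ
kroneckerδ zero    zero    = + 1
kroneckerδ zero    (suc _) = + 0
kroneckerδ (suc _) zero    = + 0
kroneckerδ (suc i) (suc j) = kroneckerδ i j

kroneckerδ-nonNeg : ∀ {n} (i j : Fin n) → + 0 ℤ.≤ kroneckerδ i j
kroneckerδ-nonNeg zero    zero    = ℤ.+≤+ ℕ.z≤n
kroneckerδ-nonNeg zero    (suc _) = ℤ.+≤+ ℕ.z≤n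
kroneckerδ-nonNeg (suc _) zero    = ℤ.+≤+ ℕ.z≤n
kroneckerδ-nonNeg (suc i) (suc j) = kroneckerδ-nonNeg i j

-- Convex combinations over an abstract ordered ring: over the concrete ℝ, convertibility
-- checks would unfold every product down to its Cauchy modulus.

record OrderedRing : Set₁ where
  field
    commutativeRing : CommutativeRing 0ℓ 0ℓ
  open CommutativeRing commutativeRing public
    renaming (zero to *-zero; refl to ≈-refl; sym to ≈-sym; trans to ≈-trans)
  infix 4 _≤_
  field
    _≤_         : Carrier → Carrier → Set
    ≤-reflexive : ∀ {x y} → x ≈ y → x ≤ y
    ≤-trans     : ∀ {x y z} → x ≤ y → y ≤ z → x ≤ z
    +-mono-≤    : ∀ {x y u v} → x ≤ y → u ≤ v → x + u ≤ y + v
    *-nonNeg    : ∀ {x y} → 0# ≤ x → 0# ≤ y → 0# ≤ x * y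
    -- Stands in for totality, which Cauchy reals do not have constructively; a split remains sound
    -- when its goal is itself a non-strict inequality.
    ≤-by-cases  : ∀ x y {u v} → (x ≤ y → u ≤ v) → (y ≤ x → u ≤ v) → u ≤ v
    ι           : ℤ → Carrier
    ι-+-homo    : ∀ a b → ι (a ℤ.+ b) ≈ ι a + ι b
    ι-*-homo    : ∀ a b → ι (a ℤ.* b) ≈ ι a * ι b
    ι-neg-homo  : ∀ a → ι (ℤ.- a) ≈ - ι a
    ι-0-homo    : ι (+ 0) ≈ 0#
    ι-1-homo    : ι (+ 1) ≈ 1#
    ι-mono-≤    : ∀ {a b} → a ℤ.≤ b → ι a ≤ ι b
    ι-cancel-≤  : ∀ {a b} → ι a ≤ ι b → a ℤ.≤ b

module OrderedRingProperties (O : OrderedRing) where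
  open OrderedRing O
  open Sum semiring public
  module ≈-Reasoning = Relation.Binary.Reasoning.Setoid setoid

  ι-morphism : CommutativeRing.rawRing ℤ.+-*-commutativeRing ACR.-Raw-AlmostCommutative⟶
               ACR.fromCommutativeRing commutativeRing
  ι-morphism = record
    { ⟦_⟧ = ι ; +-homo = ι-+-homo ; *-homo = ι-*-homo ; -‿homo = ι-neg-homo
    ; 0-homo = ι-0-homo ; 1-homo = ι-1-homo }

  ι-≟ : ∀ a b → Maybe (ι a ≈ ι b)
  ι-≟ a b = Maybe.map (reflexive ∘ cong ι) (dec⇒maybe (a ℤ.≟ b))

  module Solver = Algebra.Solver.Ring
    (CommutativeRing.rawRing ℤ.+-*-commutativeRing)
    (ACR.fromCommutativeRing commutativeRing)
    ι-morphism
    ι-≟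
  open Solver

  ≤-respˡ-≈ : ∀ {x y z} → x ≈ y → x ≤ z → y ≤ z
  ≤-respˡ-≈ x≈y x≤z = ≤-trans (≤-reflexive (≈-sym x≈y)) x≤z

  ≤-respʳ-≈ : ∀ {x y z} → y ≈ z → x ≤ y → x ≤ z
  ≤-respʳ-≈ y≈z x≤y = ≤-trans x≤y (≤-reflexive y≈z)

  ≤-refl : ∀ {x} → x ≤ x
  ≤-refl = ≤-reflexive ≈-refl

  +-nonNeg : ∀ {x y} → 0# ≤ x → 0# ≤ y → 0# ≤ x + y
  +-nonNeg 0≤x 0≤y = ≤-respˡ-≈ (+-identityˡ 0#) (+-mono-≤ 0≤x 0≤y)

  0≤y-x : ∀ {x y} → x ≤ y → 0# ≤ y - x
  0≤y-x {x} x≤y = ≤-respˡ-≈ (-‿inverseʳ x) (+-mono-≤ x≤y ≤-refl)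

  ι-nonNeg : ∀ {a} → + 0 ℤ.≤ a → 0# ≤ ι a
  ι-nonNeg 0≤a = ≤-respˡ-≈ ι-0-homo (ι-mono-≤ 0≤a)

  ι-nonNeg⁻¹ : ∀ {a} → 0# ≤ ι a → + 0 ℤ.≤ a
  ι-nonNeg⁻¹ 0≤ιa = ι-cancel-≤ (≤-respˡ-≈ (≈-sym ι-0-homo) 0≤ιa)

  sum-mono-≤ : ∀ {n} {f g : Vector Carrier n} → (∀ i → f i ≤ g i) → sum f ≤ sum g
  sum-mono-≤ {zero}  f≤g = ≤-refl
  sum-mono-≤ {suc n} f≤g = +-mono-≤ (f≤g zero) (sum-mono-≤ (f≤g ∘ suc))

  ι-sum : ∀ {n} (f : Vector ℤ n) → ι (sumℤ f) ≈ sum (ι ∘ f)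
  ι-sum {zero}  f = ι-0-homo
  ι-sum {suc n} f = ≈-trans (ι-+-homo (f zero) (sumℤ (f ∘ suc))) (+-congˡ (ι-sum (f ∘ suc)))

  sum-const : ∀ n x → sum {n} (λ _ → x) ≈ ι (+ n) * x
  sum-const zero    x = ≈-sym (≈-trans (*-congʳ ι-0-homo) (zeroˡ x))
  sum-const (suc n) x = begin
    x + sum {n} (λ _ → x)     ≈⟨ +-congˡ (sum-const n x) ⟩
    x + ι (+ n) * x           ≈⟨ solve 2 (λ x n → x :+ n :* x := (con (+ 1) :+ n) :* x) ≈-refl x (ι (+ n)) ⟩
    (ι (+ 1) + ι (+ n)) * x   ≈⟨ *-congʳ (ι-+-homo (+ 1) (+ n)) ⟨
    ι (+ suc n) * x           ∎
    where open ≈-Reasoning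

  sum-a-b*c : ∀ {n} (a b : Vector Carrier n) c → sum (λ i → a i - b i * c) ≈ sum a - sum b * c
  sum-a-b*c {zero}  a b c = ≈-sym (≈-trans (+-congˡ (-‿cong (zeroˡ c))) (-‿inverseʳ 0#))
  sum-a-b*c {suc n} a b c = begin
    a zero - b zero * c + sum (λ i → a (suc i) - b (suc i) * c)
      ≈⟨ +-congˡ (sum-a-b*c (a ∘ suc) (b ∘ suc) c) ⟩
    a zero - b zero * c + (sum (a ∘ suc) - sum (b ∘ suc) * c)
      ≈⟨ solve 5 (λ a b c s t → a :- b :* c :+ (s :- t :* c) := (a :+ s) :- (b :+ t) :* c) ≈-refl
           (a zero) (b zero) c (sum (a ∘ suc)) (sum (b ∘ suc)) ⟩
    sum a - sum b * c ∎
    where open ≈-Reasoning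

  -- The abstract ring has no division. The inverses of the positive integers N, m and N + d are
  -- passed in as data instead.
  record IsPositiveInverse (y x : Carrier) : Set where
    constructor positiveInverse
    field
      inverse-nonNeg : 0# ≤ y
      inverse*x≈1    : y * x ≈ 1#

    inverse-cancel : ∀ {a b} → a ≈ x * b → y * a ≈ b
    inverse-cancel {a} {b} a≈xb = ≈-trans (*-congˡ a≈xb)
      (≈-trans (≈-sym (*-assoc y x b)) (≈-trans (*-congʳ inverse*x≈1) (*-identityˡ b)))

  record Balanced {n : ℕ} (a : Vector Carrier n) : Set where
    constructor isBalanced
    field sum≈0 : sum a ≈ 0#

  record NonNegativeOn {n : ℕ} (a v : Vector Carrier n) : Set where
    constructor isNonNegativeOn
    field 0≤sum : 0# ≤ sum (λ i → a i * v i)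

  record AffineCombination {n d : ℕ} (v : Fin n → Vector Carrier d) (x : Vector Carrier d) : Set where
    constructor affine
    field
      weights     : Vector Carrier n
      sum-weights : sum weights ≈ 1#
      combination : ∀ j → x j ≈ sum (λ i → weights i * v i j)

  record ConvexCombination {n d : ℕ} (v : Fin n → Vector Carrier d) (x : Vector Carrier d) : Set where
    constructor convex
    field
      affineCombination : AffineCombination v x
    open AffineCombination affineCombination public
    field
      weights-nonNeg : ∀ i → 0# ≤ weights i

  sum-kroneckerδ : ∀ {n} (i : Fin n) (f : Vector Carrier n) → sum (λ k → ι (kroneckerδ i k) * f k) ≈ f i
  sum-kroneckerδ {suc n} zero f = begin
    ι (+ 1) * f zero + sum (λ k → ι (+ 0) * f (suc k))
      ≈⟨ +-congˡ (*-distribˡ-sum (ι (+ 0)) (f ∘ suc)) ⟨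
    ι (+ 1) * f zero + ι (+ 0) * sum (f ∘ suc)
      ≈⟨ solve 2 (λ a b → con (+ 1) :* a :+ con (+ 0) :* b := a) ≈-refl (f zero) (sum (f ∘ suc)) ⟩
    f zero ∎
    where open ≈-Reasoning
  sum-kroneckerδ {suc n} (suc i) f = begin
    ι (+ 0) * f zero + sum (λ k → ι (kroneckerδ i k) * f (suc k))
      ≈⟨ +-congˡ (sum-kroneckerδ i (f ∘ suc)) ⟩
    ι (+ 0) * f zero + f (suc i)
      ≈⟨ solve 2 (λ a b → con (+ 0) :* a :+ b := b) ≈-refl (f zero) (f (suc i)) ⟩
    f (suc i) ∎
    where open ≈-Reasoning

  generator-convex : ∀ {n e} (v : Fin n → Vector Carrier e) i → ConvexCombination v (v i)
  generator-convex v i = convex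
    (affine (λ k → ι (kroneckerδ i k))
      (≈-trans (sum-cong-≋ λ k → ≈-sym (*-identityʳ (ι (kroneckerδ i k)))) (sum-kroneckerδ i (λ _ → 1#)))
      (λ j → ≈-sym (sum-kroneckerδ i (λ k → v k j))))
    (λ k → ι-nonNeg (kroneckerδ-nonNeg i k))

simplexPoints : ∀ {d} → Vector ℕ d → Vector (Vec ℤ d) (suc d)
simplexPoints q = tabulate (ℤ.-_ ∘ +_ ∘ q) Vector.∷ λ i → tabulate λ j → kroneckerδ j i

module Barycentric (O : OrderedRing) {d : ℕ} (q : Vector ℕ d) where
  open OrderedRing O
  open OrderedRingProperties O
  open Solver
  open ≈-Reasoning

  V : Carrier
  V = ι (+ volume q)

  V≈1+sum : V ≈ 1# + sum (ι ∘ +_ ∘ q)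
  V≈1+sum = begin
    ι (+ 1 ℤ.+ + sumℕ q)          ≈⟨ ι-+-homo (+ 1) (+ sumℕ q) ⟩
    ι (+ 1) + ι (+ sumℕ q)        ≈⟨ +-cong ι-1-homo (≈-trans (reflexive (cong ι (+-sumℕ q))) (ι-sum (+_ ∘ q))) ⟩
    1# + sum (ι ∘ +_ ∘ q)         ∎

  point : Vector Carrier (suc d) → Vector Carrier d
  point w j = w (suc j) - ι (+ q j) * w zero

  vertex : Fin (suc d) → Vector Carrier d
  vertex i j = ι (lookup (simplexPoints q i) j)

  combination≈point : ∀ w j → sum (λ i → w i * vertex i j) ≈ point w j
  combination≈point w j = begin
    w zero * vertex zero j + sum (λ i → w (suc i) * vertex (suc i) j)
      ≈⟨ +-cong
           (*-congˡ (≈-trans (reflexive (cong ι (Vec.lookup∘tabulate _ j))) (ι-neg-homo (+ q j))))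
           (sum-cong-≋ {d} λ i → ≈-trans
             (*-congˡ (reflexive (cong ι (Vec.lookup∘tabulate (λ j → kroneckerδ j i) j))))
             (*-comm (w (suc i)) (ι (kroneckerδ j i)))) ⟩
    w zero * - ι (+ q j) + sum (λ i → ι (kroneckerδ j i) * w (suc i))
      ≈⟨ +-congˡ (sum-kroneckerδ j (w ∘ suc)) ⟩
    w zero * - ι (+ q j) + w (suc j)
      ≈⟨ solve 3 (λ w q v → w :* (:- q) :+ v := v :- q :* w) ≈-refl (w zero) (ι (+ q j)) (w (suc j)) ⟩
    point w j ∎

  -- The coordinate sum is 1 at each eⱼ and 1 - N at -q, so the deficit of the coordinate sum
  -- measures the weight of -q alone.
  1-sum-point : ∀ w → sum w - sum (point w) ≈ V * w zero
  1-sum-point w = begin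
    sum w - sum (point w)
      ≈⟨ +-congˡ (-‿cong (sum-a-b*c (w ∘ suc) (ι ∘ +_ ∘ q) (w zero))) ⟩
    w zero + sum (w ∘ suc) - (sum (w ∘ suc) - sum (ι ∘ +_ ∘ q) * w zero)
      ≈⟨ solve 3 (λ w s t → w :+ s :- (s :- t :* w) := (con (+ 1) :+ t) :* w) ≈-refl
           (w zero) (sum (w ∘ suc)) (sum (ι ∘ +_ ∘ q)) ⟩
    (ι (+ 1) + sum (ι ∘ +_ ∘ q)) * w zero
      ≈⟨ *-congʳ (≈-trans (+-congʳ ι-1-homo) (≈-sym V≈1+sum)) ⟩
    V * w zero ∎

  module _ (m : ℕ) (z : Vec ℤ d) (p : Vector Carrier d) (z≈mp : ∀ j → ι (lookup z j) ≈ ι (+ m) * p j) where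

    ι-slack₀ : ι (slack₀ q m z) ≈ ι (+ m) * (1# - sum p)
    ι-slack₀ = begin
      ι (+ m ℤ.- sumℤ (lookup z))
        ≈⟨ ≈-trans (ι-+-homo (+ m) _) (+-congˡ (ι-neg-homo (sumℤ (lookup z)))) ⟩
      ι (+ m) - ι (sumℤ (lookup z))
        ≈⟨ +-congˡ (-‿cong (≈-trans (ι-sum (lookup z)) (≈-trans (sum-cong-≋ z≈mp) (≈-sym (*-distribˡ-sum (ι (+ m)) p))))) ⟩
      ι (+ m) - ι (+ m) * sum p
        ≈⟨ solve 2 (λ m s → m :- m :* s := m :* (con (+ 1) :- s)) ≈-refl (ι (+ m)) (sum p) ⟩
      ι (+ m) * (ι (+ 1) - sum p)
        ≈⟨ *-congˡ (+-congʳ ι-1-homo) ⟩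
      ι (+ m) * (1# - sum p) ∎

    ι-slack : ∀ j → ι (slack q m z j) ≈ ι (+ m) * (V * p j + ι (+ q j) * (1# - sum p))
    ι-slack j = begin
      ι (+ volume q ℤ.* lookup z j ℤ.+ + q j ℤ.* slack₀ q m z)
        ≈⟨ ≈-trans (ι-+-homo _ _) (+-cong (ι-*-homo _ _) (ι-*-homo _ _)) ⟩
      V * ι (lookup z j) + ι (+ q j) * ι (slack₀ q m z)
        ≈⟨ +-cong (*-congˡ (z≈mp j)) (*-congˡ ι-slack₀) ⟩
      V * (ι (+ m) * p j) + ι (+ q j) * (ι (+ m) * (1# - sum p))
        ≈⟨ solve 5 (λ v m p q s → v :* (m :* p) :+ q :* (m :* s) := m :* (v :* p :+ q :* s)) ≈-refl
             V (ι (+ m)) (p j) (ι (+ q j)) (1# - sum p) ⟩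
      ι (+ m) * (V * p j + ι (+ q j) * (1# - sum p)) ∎

  0≤V : 0# ≤ V
  0≤V = ι-nonNeg (ℤ.+≤+ ℕ.z≤n)

  convex⇒InCone : ∀ m z p → ConvexCombination vertex p →
    (∀ j → ι (lookup z j) ≈ ι (+ m) * p j) → InCone q m z
  convex⇒InCone m z p (convex (affine w Σw≈1 p≈) 0≤w) z≈mp =
      ι-nonNeg⁻¹ (≤-respʳ-≈ (≈-sym (≈-trans (ι-slack₀ m z p z≈mp) (*-congˡ 1-Σp≈Vw₀)))
        (*-nonNeg (ι-nonNeg (ℤ.+≤+ ℕ.z≤n)) (*-nonNeg 0≤V (0≤w zero))))
    , λ j → ι-nonNeg⁻¹ (≤-respʳ-≈ (≈-sym (≈-trans (ι-slack m z p z≈mp j) (*-congˡ (Vp+qs≈Vw j))))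
        (*-nonNeg (ι-nonNeg (ℤ.+≤+ ℕ.z≤n)) (*-nonNeg 0≤V (0≤w (suc j)))))
    where
    p≈point : ∀ j → p j ≈ point w j
    p≈point j = ≈-trans (p≈ j) (combination≈point w j)
    1-Σp≈Vw₀ : 1# - sum p ≈ V * w zero
    1-Σp≈Vw₀ = ≈-trans (+-cong (≈-sym Σw≈1) (-‿cong (sum-cong-≋ p≈point))) (1-sum-point w)
    Vp+qs≈Vw : ∀ j → V * p j + ι (+ q j) * (1# - sum p) ≈ V * w (suc j)
    Vp+qs≈Vw j = ≈-trans (+-cong (*-congˡ (p≈point j)) (*-congˡ 1-Σp≈Vw₀))
      (solve 4 (λ v w q w₀ → v :* (w :- q :* w₀) :+ q :* (v :* w₀) := v :* w) ≈-refl
        V (w (suc j)) (ι (+ q j)) (w zero))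

  module Weights {V⁻¹ : Carrier} (V⁻¹-inverse : IsPositiveInverse V⁻¹ V) (x : Vector Carrier d) where
    open IsPositiveInverse V⁻¹-inverse renaming (inverse*x≈1 to V⁻¹V≈1)

    -- Obtained by solving `1-sum-point` with total weight 1; the other weights then follow from xⱼ
    -- = wⱼ - qⱼ w₀.
    weight₀ : Carrier
    weight₀ = V⁻¹ * (1# - sum x)

    weights : Vector Carrier (suc d)
    weights = weight₀ Vector.∷ λ j → x j + ι (+ q j) * weight₀

    point-weights : ∀ j → point weights j ≈ x j
    point-weights j = solve 3 (λ x q w → x :+ q :* w :- q :* w := x) ≈-refl (x j) (ι (+ q j)) weight₀

    Vweight₀ : V * weight₀ ≈ 1# - sum x
    Vweight₀ = begin
      V * (V⁻¹ * (1# - sum x))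
        ≈⟨ solve 3 (λ v i s → v :* (i :* s) := (i :* v) :* s) ≈-refl V V⁻¹ (1# - sum x) ⟩
      V⁻¹ * V * (1# - sum x)     ≈⟨ ≈-trans (*-congʳ V⁻¹V≈1) (*-identityˡ _) ⟩
      1# - sum x                 ∎

    sum-weights : sum weights ≈ 1#
    sum-weights = begin
      sum weights
        ≈⟨ solve 2 (λ w p → w := (w :- p) :+ p) ≈-refl (sum weights) (sum (point weights)) ⟩
      (sum weights - sum (point weights)) + sum (point weights)
        ≈⟨ +-cong (≈-trans (1-sum-point weights) Vweight₀) (sum-cong-≋ point-weights) ⟩
      (1# - sum x) + sum x
        ≈⟨ solve 2 (λ a b → (a :- b) :+ b := a) ≈-refl 1# (sum x) ⟩
      1# ∎

    affine-weights : AffineCombination vertex x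
    affine-weights = affine weights sum-weights
      (λ j → ≈-sym (≈-trans (combination≈point weights j) (point-weights j)))

    V⁻¹*slack : ∀ j → V⁻¹ * (V * x j + ι (+ q j) * (1# - sum x)) ≈ weights (suc j)
    V⁻¹*slack j = begin
      V⁻¹ * (V * x j + ι (+ q j) * (1# - sum x))
        ≈⟨ solve 5 (λ i v x q s → i :* (v :* x :+ q :* s) := (i :* v) :* x :+ q :* (i :* s)) ≈-refl
             V⁻¹ V (x j) (ι (+ q j)) (1# - sum x) ⟩
      V⁻¹ * V * x j + ι (+ q j) * (V⁻¹ * (1# - sum x))
        ≈⟨ +-congʳ (≈-trans (*-congʳ V⁻¹V≈1) (*-identityˡ _)) ⟩
      weights (suc j) ∎

  InCone⇒convex : ∀ {V⁻¹ m⁻¹} → IsPositiveInverse V⁻¹ V → ∀ m → IsPositiveInverse m⁻¹ (ι (+ m)) →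
    ∀ z → InCone q m z → ∃ λ x → ConvexCombination vertex x × (∀ j → ι (lookup z j) ≈ ι (+ m) * x j)
  InCone⇒convex {V⁻¹} {m⁻¹} V⁻¹-inverse m m⁻¹-inverse z (0≤s₀ , 0≤s) =
    x , convex affine-weights 0≤w , z≈mx
    where
    x : Vector Carrier d
    x j = m⁻¹ * ι (lookup z j)
    open Weights V⁻¹-inverse x
    open IsPositiveInverse V⁻¹-inverse using () renaming (inverse-nonNeg to 0≤V⁻¹)
    open IsPositiveInverse m⁻¹-inverse
      renaming (inverse-nonNeg to 0≤m⁻¹; inverse*x≈1 to m⁻¹m≈1; inverse-cancel to cancel-m)
    z≈mx : ∀ j → ι (lookup z j) ≈ ι (+ m) * x j
    z≈mx j = ≈-sym (≈-trans
      (solve 3 (λ m i z → m :* (i :* z) := (i :* m) :* z) ≈-refl (ι (+ m)) m⁻¹ (ι (lookup z j)))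
      (≈-trans (*-congʳ m⁻¹m≈1) (*-identityˡ _)))
    0≤w : ∀ i → 0# ≤ weights i
    0≤w zero    = *-nonNeg 0≤V⁻¹ (≤-respʳ-≈ (cancel-m (ι-slack₀ m z x z≈mx)) (*-nonNeg 0≤m⁻¹ (ι-nonNeg 0≤s₀)))
    0≤w (suc j) = ≤-respʳ-≈ (V⁻¹*slack j)
      (*-nonNeg 0≤V⁻¹ (≤-respʳ-≈ (cancel-m (ι-slack m z x z≈mx j)) (*-nonNeg 0≤m⁻¹ (ι-nonNeg (0≤s j)))))

  -- With ε (V + d) = 1, every x in the sup-norm ε-ball around 0 has 1 - Σ x ≥ V ε, so its zeroth
  -- barycentric coordinate is at least ε.
  near-0⇒convex : (∀ j → 1 ℕ.≤ q j) →
    ∀ {V⁻¹ ε} → IsPositiveInverse V⁻¹ V → IsPositiveInverse ε (ι (+ (volume q ℕ.+ d))) →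
    ∀ x → (∀ j → x j ≤ ι (lookup (replicate d (+ 0)) j) + ε ×
                 ι (lookup (replicate d (+ 0)) j) ≤ x j + ε) →
    ConvexCombination vertex x
  near-0⇒convex 1≤q {V⁻¹} {ε} V⁻¹-inverse ε-inverse x near = convex affine-weights λ where
      zero    → 0≤w₀
      -- The weight xⱼ + qⱼ w₀ is a sum of three nonnegative terms: xⱼ + ε, (qⱼ - 1) w₀ and w₀ - ε.
      -- The bound qⱼ ≥ 1 enters in the second.
      (suc j) → ≤-respʳ-≈
        (solve 4 (λ x ε q w → (x :+ ε) :+ ((q :- con (+ 1)) :* w :+ (w :- ε)) := x :+ q :* w) ≈-refl
          (x j) ε (ι (+ q j)) weight₀)
        (+-nonNeg (0≤x+ε j) (+-nonNeg
          (*-nonNeg (0≤y-x (ι-mono-≤ (ℤ.+≤+ (1≤q j)))) 0≤w₀) 0≤w₀-ε))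
    where
    open Weights V⁻¹-inverse x
    open IsPositiveInverse V⁻¹-inverse using () renaming (inverse-nonNeg to 0≤V⁻¹; inverse*x≈1 to V⁻¹V≈1)
    open IsPositiveInverse ε-inverse using (inverse*x≈1) renaming (inverse-nonNeg to 0≤ε)
    ε[V+d]≈1 : ε * (V + ι (+ d)) ≈ 1#
    ε[V+d]≈1 = ≈-trans (*-congˡ (≈-sym (ι-+-homo (+ volume q) (+ d)))) inverse*x≈1
    origin≈0 : ∀ j → ι (lookup (replicate d (+ 0)) j) ≈ 0#
    origin≈0 j = ≈-trans (reflexive (cong ι (Vec.lookup-replicate j (+ 0)))) ι-0-homo
    x≤ε : ∀ j → x j ≤ ε
    x≤ε j = ≤-respʳ-≈ (≈-trans (+-congʳ (origin≈0 j)) (+-identityˡ ε)) (proj₁ (near j))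
    0≤x+ε : ∀ j → 0# ≤ x j + ε
    0≤x+ε j = ≤-respˡ-≈ (origin≈0 j) (proj₂ (near j))
    0≤dε-Σx : 0# ≤ ι (+ d) * ε - sum x
    0≤dε-Σx = 0≤y-x (≤-respʳ-≈ (sum-const d ε) (sum-mono-≤ x≤ε))
    0≤w₀-ε : 0# ≤ weight₀ - ε
    0≤w₀-ε = ≤-respʳ-≈ (begin
        V⁻¹ * (ι (+ d) * ε - sum x)
          ≈⟨ solve 5 (λ i d ε s v → i :* (d :* ε :- s) := i :* (ε :* (v :+ d) :- s) :- (i :* v) :* ε) ≈-refl
               V⁻¹ (ι (+ d)) ε (sum x) V ⟩
        V⁻¹ * (ε * (V + ι (+ d)) - sum x) - V⁻¹ * V * ε
          ≈⟨ +-cong (*-congˡ (+-congʳ ε[V+d]≈1)) (-‿cong (≈-trans (*-congʳ V⁻¹V≈1) (*-identityˡ ε))) ⟩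
        weight₀ - ε ∎)
      (*-nonNeg 0≤V⁻¹ 0≤dε-Σx)
    0≤w₀ : 0# ≤ weight₀
    0≤w₀ = ≤-respʳ-≈ (solve 2 (λ w ε → (w :- ε) :+ ε := w) ≈-refl weight₀ ε) (+-nonNeg 0≤w₀-ε 0≤ε)

-- The cone of the inequality system and its rays

hStars : Fin 6 → Vec ℤ 7
hStars 0F = + 1 ∷ + 2 ∷ + 2 ∷ + 2 ∷ + 2 ∷ + 2 ∷ + 1 ∷ []
hStars 1F = + 1 ∷ + 1 ∷ + 1 ∷ + 2 ∷ + 1 ∷ + 1 ∷ + 1 ∷ []
hStars 2F = + 1 ∷ + 1 ∷ + 1 ∷ + 2 ∷ + 2 ∷ + 1 ∷ + 1 ∷ []
hStars 3F = + 1 ∷ + 1 ∷ + 2 ∷ + 1 ∷ + 2 ∷ + 1 ∷ + 1 ∷ []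
hStars 4F = + 1 ∷ + 1 ∷ + 2 ∷ + 2 ∷ + 1 ∷ + 2 ∷ + 1 ∷ []
hStars 5F = + 1 ∷ + 2 ∷ + 4 ∷ + 3 ∷ + 3 ∷ + 4 ∷ + 2 ∷ []

module Cone (O : OrderedRing) where
  open OrderedRing O
  open OrderedRingProperties O
  open Solver

  sum₆ : ∀ (f : Vector Carrier 6) → sum f ≈ f 0F + (f 1F + (f 2F + (f 3F + (f 4F + f 5F))))
  sum₆ f = +-congˡ (+-congˡ (+-congˡ (+-congˡ (+-congˡ (+-identityʳ (f 5F))))))

  -- If x ≤ 0, then x ≥ x + x ≥ 0. It undoes the doubling that clears the half-integral ray
  -- coordinates in one case of `nonNeg-on-cone`.
  0≤x+x⇒0≤x : ∀ {x} → 0# ≤ x + x → 0# ≤ x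
  0≤x+x⇒0≤x {x} 0≤x+x = ≤-by-cases 0# x (λ 0≤x → 0≤x)
    (λ x≤0 → ≤-trans 0≤x+x (≤-respʳ-≈ (+-identityʳ x) (+-mono-≤ ≤-refl x≤0)))

  private
    α x : Fin 6 → Polynomial 12
    α i = var (i ↑ˡ 6)
    x i = var (6 ↑ʳ i)

    ⟨α,_⟩ : (Fin 6 → Polynomial 12) → Polynomial 12
    ⟨α, v ⟩ = α 0F :* v 0F :+ (α 1F :* v 1F :+ (α 2F :* v 2F :+ (α 3F :* v 3F :+ (α 4F :* v 4F :+ α 5F :* v 5F))))

    Σα : Polynomial 12
    Σα = α 0F :+ (α 1F :+ (α 2F :+ (α 3F :+ (α 4F :+ α 5F))))

    D : Fin 6 → Polynomial 12
    D i = ⟨α, (λ j → con (lookup (hStars i) (suc j))) ⟩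

    a b c d e f : Polynomial 12
    a = x 0F :- x 5F
    b = x 4F :- x 0F
    c = x 1F :- x 4F
    d = (x 3F :+ x 4F) :- (x 0F :+ x 1F)
    e = (x 1F :+ x 2F) :- (x 3F :+ x 4F)
    f = (x 2F :+ x 3F) :- (x 0F :+ x 1F)

  -- Numbering the rays as in hStars, the face x₁ = x₆ is a cone over a quadrangular pyramid with
  -- apex ray 3 and base 1, 2, 5, 4.  The sign of b - 2d tells on which side of the hyperplane
  -- through the rays 3, 1 and 5 a point lies, and so which simplicial cone contains it.
  module _ (α′ x′ : Vector Carrier 6) (balanced : Balanced α′)
    (0≤α·h : ∀ i → NonNegativeOn α′ (λ j → ι (lookup (hStars i) (suc j)))) where

    private
      ρ : Vec Carrier 12
      ρ = tabulate α′ Vec.++ tabulate x′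

      α·h : Fin 6 → Vector Carrier 6
      α·h i j = α′ j * ι (lookup (hStars i) (suc j))

      0≤D : ∀ i → 0# ≤ ⟦ D i ⟧ ρ
      0≤D 0F = ≤-respʳ-≈ (sum₆ (α·h 0F)) (NonNegativeOn.0≤sum (0≤α·h 0F))
      0≤D 1F = ≤-respʳ-≈ (sum₆ (α·h 1F)) (NonNegativeOn.0≤sum (0≤α·h 1F))
      0≤D 2F = ≤-respʳ-≈ (sum₆ (α·h 2F)) (NonNegativeOn.0≤sum (0≤α·h 2F))
      0≤D 3F = ≤-respʳ-≈ (sum₆ (α·h 3F)) (NonNegativeOn.0≤sum (0≤α·h 3F))
      0≤D 4F = ≤-respʳ-≈ (sum₆ (α·h 4F)) (NonNegativeOn.0≤sum (0≤α·h 4F))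
      0≤D 5F = ≤-respʳ-≈ (sum₆ (α·h 5F)) (NonNegativeOn.0≤sum (0≤α·h 5F))

      +κΣα : ∀ {y} κ → 0# ≤ y → 0# ≤ y + κ * ⟦ Σα ⟧ ρ
      +κΣα {y} κ 0≤y = ≤-respʳ-≈ (≈-sym (≈-trans
        (+-congˡ (≈-trans (*-congˡ (≈-trans (≈-sym (sum₆ α′)) (Balanced.sum≈0 balanced))) (zeroʳ κ))) (+-identityʳ y))) 0≤y

    nonNeg-on-cone :
      x′ 5F ≤ x′ 0F → x′ 0F ≤ x′ 4F → x′ 4F ≤ x′ 1F →
      x′ 0F + x′ 1F ≤ x′ 3F + x′ 4F → x′ 3F + x′ 4F ≤ x′ 1F + x′ 2F → x′ 0F + x′ 1F ≤ x′ 2F + x′ 3F →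
      NonNegativeOn α′ x′
    nonNeg-on-cone x₆≤x₁ x₁≤x₅ x₅≤x₂ x₁+x₂≤x₄+x₅ x₄+x₅≤x₂+x₃ x₁+x₂≤x₃+x₄ =
      isNonNegativeOn (≤-respʳ-≈ (≈-sym (sum₆ (λ i → α′ i * x′ i))) (≤-by-cases (⟦ d :+ d ⟧ ρ) (⟦ b ⟧ ρ)
        -- Modulo (1,...,1), x has the coordinates a, c, d, b - 2d, f with respect to the rays 0, 3,
        -- 5, 4, 1.
        (λ 2d≤b → ≤-respʳ-≈
          (prove ρ (a :* D 0F :+ c :* D 3F :+ d :* D 5F :+ (b :- (d :+ d)) :* D 4F :+ f :* D 1F :+ κ₁ :* Σα)
            ⟨α, x ⟩ ≈-refl)
          (+κΣα (⟦ κ₁ ⟧ ρ)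
            (a∙ 0F ⊕ *-nonNeg (0≤y-x x₅≤x₂) (0≤D 3F) ⊕ *-nonNeg 0≤d (0≤D 5F)
              ⊕ *-nonNeg (0≤y-x 2d≤b) (0≤D 4F) ⊕ *-nonNeg (0≤y-x x₁+x₂≤x₃+x₄) (0≤D 1F))))
        -- Exchanging ray 4 for ray 2 along r₁ + r₅ = r₂ + 2 r₄ gives the coordinates a, c, b/2, d -
        -- b/2, e with respect to the rays 0, 3, 5, 2, 1; everything is doubled.
        (λ b≤2d → 0≤x+x⇒0≤x (≤-respʳ-≈
          (prove ρ ((a :* D 0F :+ a :* D 0F) :+ (c :* D 3F :+ c :* D 3F) :+ b :* D 5F
              :+ ((d :+ d) :- b) :* D 2F :+ (e :* D 1F :+ e :* D 1F) :+ κ₂ :* Σα)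
            (⟨α, x ⟩ :+ ⟨α, x ⟩) ≈-refl)
          (+κΣα (⟦ κ₂ ⟧ ρ)
            ((a∙ 0F ⊕ a∙ 0F) ⊕ (*-nonNeg (0≤y-x x₅≤x₂) (0≤D 3F) ⊕ *-nonNeg (0≤y-x x₅≤x₂) (0≤D 3F))
              ⊕ *-nonNeg (0≤y-x x₁≤x₅) (0≤D 5F) ⊕ *-nonNeg (0≤y-x b≤2d) (0≤D 2F)
              ⊕ (*-nonNeg (0≤y-x x₄+x₅≤x₂+x₃) (0≤D 1F) ⊕ *-nonNeg (0≤y-x x₄+x₅≤x₂+x₃) (0≤D 1F))))))))
      where
      infixl 6 _⊕_
      _⊕_ : ∀ {y z} → 0# ≤ y → 0# ≤ z → 0# ≤ y + z
      _⊕_ = +-nonNeg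
      a∙ : ∀ i → 0# ≤ ⟦ a :* D i ⟧ ρ
      a∙ i = *-nonNeg (0≤y-x x₆≤x₁) (0≤D i)
      0≤d : 0# ≤ ⟦ d ⟧ ρ
      0≤d = 0≤y-x x₁+x₂≤x₄+x₅
      -- The multiple of (1,...,1) left over. The rays have last coordinate 0, so x itself
      -- contributes x₆, doubled in κ₂. The subtracted terms cancel the surplus of the rows of
      -- `hStars` over the rays, which is (1,...,1) once, but twice in row 5.
      κ₁ κ₂ : Polynomial 12
      κ₁ = x 5F :- a :- c :- (d :+ d) :- (b :- (d :+ d)) :- f
      κ₂ = (x 5F :+ x 5F) :- (a :+ a) :- (c :+ c) :- (b :+ b) :- ((d :+ d) :- b) :- (e :+ e)

-- The ordered ring of reals.  Because ℝ has η-equality, implicit real arguments that are left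
-- to unification are compared by their Cauchy moduli; below they are often given explicitly.

open import Defs

½ε+½ε≡ε : ∀ ε → ½ ℚ.* ε ℚ.+ ½ ℚ.* ε ≡ ε
½ε+½ε≡ε = solve 1 (λ ε → con ½ :* ε :+ con ½ :* ε := ε) refl
  where open +-*-Solver

*-pos : ∀ {p q} → 0ℚ ℚ.< p → 0ℚ ℚ.< q → 0ℚ ℚ.< p ℚ.* q
*-pos {p} {q} 0<p 0<q = ℚ.positive⁻¹ (p ℚ.* q)
  {{ℚ.pos*pos⇒pos p {{ℚ.positive 0<p}} q {{ℚ.positive 0<q}}}}

½ε>0 : ∀ {ε} → 0ℚ ℚ.< ε → 0ℚ ℚ.< ½ ℚ.* ε
½ε>0 = *-pos (ℚ.positive⁻¹ ½)

p≤∣p∣ : ∀ p → p ℚ.≤ ℚ.∣ p ∣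
p≤∣p∣ p with ℚ.≤-total 0ℚ p
... | inj₁ 0≤p = ℚ.≤-reflexive (sym (ℚ.0≤p⇒∣p∣≡p 0≤p))
... | inj₂ p≤0 = ℚ.≤-trans p≤0 (ℚ.0≤∣p∣ p)

∣p-q∣≤ε⇒p≤q+ε : ∀ p q {ε} → ℚ.∣ p ℚ.- q ∣ ℚ.≤ ε → p ℚ.≤ q ℚ.+ ε
∣p-q∣≤ε⇒p≤q+ε p q {ε} h = begin
  p                        ≡⟨ solve 2 (λ p q → p := q :+ (p :- q)) refl p q ⟩
  q ℚ.+ (p ℚ.- q)          ≤⟨ ℚ.+-monoʳ-≤ q (ℚ.≤-trans (p≤∣p∣ (p ℚ.- q)) h) ⟩
  q ℚ.+ ε                  ∎
  where
  open ℚ.≤-Reasoning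
  open +-*-Solver

p≤q+ε⇒p-q≤ε : ∀ p q {ε} → p ℚ.≤ q ℚ.+ ε → p ℚ.- q ℚ.≤ ε
p≤q+ε⇒p-q≤ε p q {ε} h = begin
  p ℚ.- q           ≤⟨ ℚ.+-monoˡ-≤ (ℚ.- q) h ⟩
  q ℚ.+ ε ℚ.- q     ≡⟨ solve 2 (λ q ε → q :+ ε :- q := ε) refl q ε ⟩
  ε                 ∎
  where
  open ℚ.≤-Reasoning
  open +-*-Solver

∣p-q∣-comm : ∀ p q → ℚ.∣ p ℚ.- q ∣ ≡ ℚ.∣ q ℚ.- p ∣
∣p-q∣-comm p q = trans
  (cong ℚ.∣_∣ (solve 2 (λ p q → p :- q := :- (q :- p)) refl p q)) (ℚ.∣-p∣≡∣p∣ (q ℚ.- p))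
  where open +-*-Solver

∣p-q∣≤ε : ∀ p q {ε} → p ℚ.≤ q ℚ.+ ε → q ℚ.≤ p ℚ.+ ε → ℚ.∣ p ℚ.- q ∣ ℚ.≤ ε
∣p-q∣≤ε p q p≤ q≤ with ℚ.∣p∣≡p∨∣p∣≡-p (p ℚ.- q)
... | inj₁ eq = ℚ.≤-trans (ℚ.≤-reflexive eq) (p≤q+ε⇒p-q≤ε p q p≤)
... | inj₂ eq = ℚ.≤-trans
  (ℚ.≤-reflexive (trans eq (solve 2 (λ p q → :- (p :- q) := q :- p) refl p q)))
  (p≤q+ε⇒p-q≤ε q p q≤)
  where open +-*-Solver

eventually-bounded : ∀ x → ∃ λ B → 0ℚ ℚ.< B × ∃ λ N → ∀ n → N ℕ.≤ n → ℚ.∣ seq x n ∣ ℚ.≤ B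
eventually-bounded x with N , h ← cauchy x 1ℚ (ℚ.positive⁻¹ 1ℚ) =
  ℚ.∣ seq x N ∣ ℚ.+ 1ℚ ,
  ℚ.+-mono-≤-< (ℚ.0≤∣p∣ (seq x N)) (ℚ.positive⁻¹ 1ℚ) ,
  N , λ n N≤n → begin
    ℚ.∣ seq x n ∣
      ≡⟨ cong ℚ.∣_∣ (solve 2 (λ a b → a := b :+ (a :- b)) refl (seq x n) (seq x N)) ⟩
    ℚ.∣ seq x N ℚ.+ (seq x n ℚ.- seq x N) ∣
      ≤⟨ ℚ.∣p+q∣≤∣p∣+∣q∣ (seq x N) (seq x n ℚ.- seq x N) ⟩
    ℚ.∣ seq x N ∣ ℚ.+ ℚ.∣ seq x n ℚ.- seq x N ∣
      ≤⟨ ℚ.+-monoʳ-≤ ℚ.∣ seq x N ∣ (h n N N≤n ℕ.≤-refl) ⟩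
    ℚ.∣ seq x N ∣ ℚ.+ 1ℚ ∎
  where
  open ℚ.≤-Reasoning
  open +-*-Solver

quotient : ∀ {B ε} → 0ℚ ℚ.< B → 0ℚ ℚ.< ε → ∃ λ δ → 0ℚ ℚ.< δ × B ℚ.* δ ≡ ε
quotient {B} {ε} 0<B 0<ε =
  (1/B ℚ.* ε) , *-pos (ℚ.positive⁻¹ 1/B {{ℚ.1/pos⇒pos B}}) 0<ε ,
  trans (sym (ℚ.*-assoc B 1/B ε)) (trans (cong (ℚ._* ε) (ℚ.*-inverseʳ B)) (ℚ.*-identityˡ ε))
  where
  instance
    B-positive : ℚ.Positive B
    B-positive = ℚ.positive 0<B
    B-nonZero : ℚ.NonZero B
    B-nonZero = ℚ.pos⇒nonZero B
  1/B : ℚ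
  1/B = ℚ.1/ B

pointwise-≤ : ∀ {x y} → (∀ n → seq x n ℚ.≤ seq y n) → x ≤ y
pointwise-≤ {x} {y} h = *≤* λ ε 0<ε → 0 , λ n _ → ℚ.≤-trans (h n)
  (ℚ.≤-trans (ℚ.≤-reflexive (sym (ℚ.+-identityʳ (seq y n)))) (ℚ.+-monoʳ-≤ (seq y n) (ℚ.<⇒≤ 0<ε)))

≤-trans : ∀ {x y z} → x ≤ y → y ≤ z → x ≤ z
≤-trans {x} {y} {z} (*≤* x≤y) (*≤* y≤z) = *≤* λ ε 0<ε →
  let N , h = x≤y (½ ℚ.* ε) (½ε>0 0<ε)
      M , k = y≤z (½ ℚ.* ε) (½ε>0 0<ε)
  in N ℕ.⊔ M , λ n ≤n → begin
    seq x n                                  ≤⟨ h n (ℕ.m⊔n≤o⇒m≤o N M ≤n) ⟩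
    seq y n ℚ.+ ½ ℚ.* ε                      ≤⟨ ℚ.+-monoˡ-≤ (½ ℚ.* ε) (k n (ℕ.m⊔n≤o⇒n≤o N M ≤n)) ⟩
    seq z n ℚ.+ ½ ℚ.* ε ℚ.+ ½ ℚ.* ε          ≡⟨ ℚ.+-assoc (seq z n) _ _ ⟩
    seq z n ℚ.+ (½ ℚ.* ε ℚ.+ ½ ℚ.* ε)        ≡⟨ cong (seq z n ℚ.+_) (½ε+½ε≡ε ε) ⟩
    seq z n ℚ.+ ε                            ∎
  where open ℚ.≤-Reasoning

+-mono-≤ : ∀ {x y u v} → x ≤ y → u ≤ v → x + u ≤ y + v
+-mono-≤ {x} {y} {u} {v} (*≤* x≤y) (*≤* u≤v) = *≤* λ ε 0<ε →
  let N , h = x≤y (½ ℚ.* ε) (½ε>0 0<ε)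
      M , k = u≤v (½ ℚ.* ε) (½ε>0 0<ε)
  in N ℕ.⊔ M , λ n ≤n → begin
    seq x n ℚ.+ seq u n
      ≤⟨ ℚ.+-mono-≤ (h n (ℕ.m⊔n≤o⇒m≤o N M ≤n)) (k n (ℕ.m⊔n≤o⇒n≤o N M ≤n)) ⟩
    (seq y n ℚ.+ ½ ℚ.* ε) ℚ.+ (seq v n ℚ.+ ½ ℚ.* ε)
      ≡⟨ solve 3 (λ y v ε → (y :+ con ½ :* ε) :+ (v :+ con ½ :* ε) := (y :+ v) :+ ε) refl
           (seq y n) (seq v n) ε ⟩
    (seq y n ℚ.+ seq v n) ℚ.+ ε ∎
  where
  open ℚ.≤-Reasoning
  open +-*-Solver

≃⇒≤ : ∀ {x y} → x ≃ y → x ≤ y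
≃⇒≤ {x} {y} (*≃* x≃y) = *≤* λ ε 0<ε → let N , h = x≃y ε 0<ε in
  N , λ n N≤n → ∣p-q∣≤ε⇒p≤q+ε (seq x n) (seq y n) (h n N≤n)

≤-antisym : ∀ {x y} → x ≤ y → y ≤ x → x ≃ y
≤-antisym {x} {y} (*≤* x≤y) (*≤* y≤x) = *≃* λ ε 0<ε →
  let N , h = x≤y ε 0<ε
      M , k = y≤x ε 0<ε
  in N ℕ.⊔ M , λ n ≤n → ∣p-q∣≤ε (seq x n) (seq y n)
       (h n (ℕ.m⊔n≤o⇒m≤o N M ≤n)) (k n (ℕ.m⊔n≤o⇒n≤o N M ≤n))

≃-sym : ∀ {x y} → x ≃ y → y ≃ x
≃-sym {x} {y} (*≃* x≃y) = *≃* λ ε 0<ε → let N , h = x≃y ε 0<ε in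
  N , λ n N≤n → ℚ.≤-trans (ℚ.≤-reflexive (∣p-q∣-comm (seq y n) (seq x n))) (h n N≤n)

≃-trans : ∀ {x y z} → x ≃ y → y ≃ z → x ≃ z
≃-trans x≃y y≃z = ≤-antisym
  (≤-trans (≃⇒≤ x≃y) (≃⇒≤ y≃z)) (≤-trans (≃⇒≤ (≃-sym y≃z)) (≃⇒≤ (≃-sym x≃y)))

pointwise : ∀ {x y} → (∀ n → seq x n ≡ seq y n) → x ≃ y
pointwise h = ≤-antisym
  (pointwise-≤ (ℚ.≤-reflexive ∘ h)) (pointwise-≤ (ℚ.≤-reflexive ∘ sym ∘ h))

≤-refl : ∀ {x} → x ≤ x
≤-refl = pointwise-≤ λ _ → ℚ.≤-refl

≃-refl : ∀ {x} → x ≃ x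
≃-refl = pointwise λ _ → refl

+-cong : ∀ {x y u v} → x ≃ y → u ≃ v → x + u ≃ y + v
+-cong x≃y u≃v = ≤-antisym
  (+-mono-≤ (≃⇒≤ x≃y) (≃⇒≤ u≃v)) (+-mono-≤ (≃⇒≤ (≃-sym x≃y)) (≃⇒≤ (≃-sym u≃v)))

*-congʳ : ∀ z {x y} → x ≃ y → x * z ≃ y * z
*-congʳ z {x} {y} (*≃* x≃y) = *≃* λ ε 0<ε →
  let B , 0<B , N , bound = eventually-bounded z
      δ , 0<δ , Bδ≡ε = quotient 0<B 0<ε
      M , h = x≃y δ 0<δ
  in N ℕ.⊔ M , λ n ≤n → begin
    ℚ.∣ seq x n ℚ.* seq z n ℚ.- seq y n ℚ.* seq z n ∣
      ≡⟨ cong ℚ.∣_∣ (solve 3 (λ x y z → x :* z :- y :* z := z :* (x :- y)) refl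
                       (seq x n) (seq y n) (seq z n)) ⟩
    ℚ.∣ seq z n ℚ.* (seq x n ℚ.- seq y n) ∣
      ≡⟨ ℚ.∣p*q∣≡∣p∣*∣q∣ (seq z n) _ ⟩
    ℚ.∣ seq z n ∣ ℚ.* ℚ.∣ seq x n ℚ.- seq y n ∣
      ≤⟨ ℚ.*-monoˡ-≤-nonNeg ℚ.∣ seq z n ∣ {{ℚ.∣-∣-nonNeg (seq z n)}} (h n (ℕ.m⊔n≤o⇒n≤o N M ≤n)) ⟩
    ℚ.∣ seq z n ∣ ℚ.* δ
      ≤⟨ ℚ.*-monoʳ-≤-nonNeg δ {{ℚ.nonNegative (ℚ.<⇒≤ 0<δ)}} (bound n (ℕ.m⊔n≤o⇒m≤o N M ≤n)) ⟩
    B ℚ.* δ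
      ≡⟨ Bδ≡ε ⟩
    ε ∎
  where
  open ℚ.≤-Reasoning
  open +-*-Solver

*-comm : ∀ x y → x * y ≃ y * x
*-comm x y = pointwise λ n → ℚ.*-comm (seq x n) (seq y n)

*-cong : ∀ {x y u v} → x ≃ y → u ≃ v → x * u ≃ y * v
*-cong {x} {y} {u} {v} x≃y u≃v = ≃-trans (*-congʳ u x≃y)
  (≃-trans (*-comm y u) (≃-trans (*-congʳ y u≃v) (*-comm v y)))

-- The terms a and b of the sequences are nonnegative only up to η = ε/C and δ = ε/B, where B and C
-- bound |a| and |b|. If a ≥ 0, expand 0 ≤ a(b + δ) and use aδ ≤ ε; if a ≤ 0, expand 0 ≤ C(a + η)
-- and use aC ≤ ab.
*-nonNeg : ∀ {x y} → 0ℝ ≤ x → 0ℝ ≤ y → 0ℝ ≤ x * y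
*-nonNeg {x} {y} (*≤* 0≤x) (*≤* 0≤y) = *≤* λ ε 0<ε →
  let B , 0<B , N₁ , boundˣ = eventually-bounded x
      C , 0<C , N₂ , boundʸ = eventually-bounded y
      δ , 0<δ , Bδ≡ε = quotient 0<B 0<ε
      η , 0<η , Cη≡ε = quotient 0<C 0<ε
      N₃ , lowerˣ = 0≤x η 0<η
      N₄ , lowerʸ = 0≤y δ 0<δ
  in (N₁ ℕ.⊔ N₂) ℕ.⊔ (N₃ ℕ.⊔ N₄) , λ n ≤n →
     let ≤₁₂ = ℕ.m⊔n≤o⇒m≤o (N₁ ℕ.⊔ N₂) (N₃ ℕ.⊔ N₄) ≤n
         ≤₃₄ = ℕ.m⊔n≤o⇒n≤o (N₁ ℕ.⊔ N₂) (N₃ ℕ.⊔ N₄) ≤n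
     in bound (seq x n) (seq y n) Bδ≡ε Cη≡ε
          (boundˣ n (ℕ.m⊔n≤o⇒m≤o N₁ N₂ ≤₁₂)) (boundʸ n (ℕ.m⊔n≤o⇒n≤o N₁ N₂ ≤₁₂))
          (ℚ.<⇒≤ 0<δ) (lowerˣ n (ℕ.m⊔n≤o⇒m≤o N₃ N₄ ≤₃₄)) (lowerʸ n (ℕ.m⊔n≤o⇒n≤o N₃ N₄ ≤₃₄))
  where
  open ℚ.≤-Reasoning
  open +-*-Solver

  bound : ∀ a b {B C δ η ε} → B ℚ.* δ ≡ ε → C ℚ.* η ≡ ε →
          ℚ.∣ a ∣ ℚ.≤ B → ℚ.∣ b ∣ ℚ.≤ C → 0ℚ ℚ.≤ δ →
          0ℚ ℚ.≤ a ℚ.+ η → 0ℚ ℚ.≤ b ℚ.+ δ → 0ℚ ℚ.≤ a ℚ.* b ℚ.+ ε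
  bound a b {B} {C} {δ} {η} {ε} Bδ≡ε Cη≡ε ∣a∣≤B ∣b∣≤C 0≤δ 0≤a+η 0≤b+δ with ℚ.≤-total 0ℚ a
  ... | inj₁ 0≤a = begin
    0ℚ                        ≡⟨ ℚ.*-zeroʳ a ⟨
    a ℚ.* 0ℚ                  ≤⟨ ℚ.*-monoˡ-≤-nonNeg a {{ℚ.nonNegative 0≤a}} 0≤b+δ ⟩
    a ℚ.* (b ℚ.+ δ)           ≡⟨ ℚ.*-distribˡ-+ a b δ ⟩
    a ℚ.* b ℚ.+ a ℚ.* δ       ≤⟨ ℚ.+-monoʳ-≤ (a ℚ.* b) (ℚ.*-monoʳ-≤-nonNeg δ {{ℚ.nonNegative 0≤δ}}
                                   (ℚ.≤-trans (p≤∣p∣ a) ∣a∣≤B)) ⟩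
    a ℚ.* b ℚ.+ B ℚ.* δ       ≡⟨ cong (a ℚ.* b ℚ.+_) Bδ≡ε ⟩
    a ℚ.* b ℚ.+ ε             ∎
  ... | inj₂ a≤0 = begin
    0ℚ                        ≡⟨ ℚ.*-zeroʳ C ⟨
    C ℚ.* 0ℚ                  ≤⟨ ℚ.*-monoˡ-≤-nonNeg C {{ℚ.nonNegative 0≤C}} 0≤a+η ⟩
    C ℚ.* (a ℚ.+ η)           ≡⟨ solve 3 (λ a C η → C :* (a :+ η) := a :* C :+ C :* η) refl a C η ⟩
    a ℚ.* C ℚ.+ C ℚ.* η       ≤⟨ ℚ.+-monoˡ-≤ (C ℚ.* η) (ℚ.*-monoˡ-≤-nonPos a {{ℚ.nonPositive a≤0}}
                                   (ℚ.≤-trans (p≤∣p∣ b) ∣b∣≤C)) ⟩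
    a ℚ.* b ℚ.+ C ℚ.* η       ≡⟨ cong (a ℚ.* b ℚ.+_) Cη≡ε ⟩
    a ℚ.* b ℚ.+ ε             ∎
    where
    0≤C : 0ℚ ℚ.≤ C
    0≤C = ℚ.≤-trans (ℚ.0≤∣p∣ b) ∣b∣≤C

-- A single rational comparison at a late index decides between the two overlapping alternatives;
-- this is the constructive substitute for trichotomy.
≤-or-> : ∀ x y ε → 0ℚ ℚ.< ε →
  (∃ λ N → ∀ n → N ℕ.≤ n → seq y n ℚ.≤ seq x n ℚ.+ ε) ⊎ (x ≤ y × ¬ (y ≤ x))
≤-or-> x y ε 0<ε = decide
  (ℚ.≤-total (seq y K) (seq x K ℚ.+ (δ ℚ.+ δ ℚ.+ δ)))
  where
  open ℚ.≤-Reasoning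
  open +-*-Solver
  δ : ℚ
  -- The threshold 3δ and two Cauchy errors make up 5δ = ε. On the other side of the threshold, 3δ
  -- less two errors leaves a gap of δ.
  δ = (+ 1 ℚ./ 5) ℚ.* ε
  0<δ : 0ℚ ℚ.< δ
  0<δ = *-pos (ℚ.positive⁻¹ (+ 1 ℚ./ 5)) 0<ε
  N M K : ℕ
  N = proj₁ (cauchy x δ 0<δ)
  M = proj₁ (cauchy y δ 0<δ)
  K = N ℕ.⊔ M
  near-x : ∀ {m n} → K ℕ.≤ m → K ℕ.≤ n → seq x m ℚ.≤ seq x n ℚ.+ δ
  near-x K≤m K≤n = ∣p-q∣≤ε⇒p≤q+ε _ _
    (proj₂ (cauchy x δ 0<δ) _ _ (ℕ.m⊔n≤o⇒m≤o N M K≤m) (ℕ.m⊔n≤o⇒m≤o N M K≤n))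
  near-y : ∀ {m n} → K ℕ.≤ m → K ℕ.≤ n → seq y m ℚ.≤ seq y n ℚ.+ δ
  near-y K≤m K≤n = ∣p-q∣≤ε⇒p≤q+ε _ _
    (proj₂ (cauchy y δ 0<δ) _ _ (ℕ.m⊔n≤o⇒n≤o N M K≤m) (ℕ.m⊔n≤o⇒n≤o N M K≤n))

  decide : seq y K ℚ.≤ seq x K ℚ.+ (δ ℚ.+ δ ℚ.+ δ) ⊎ seq x K ℚ.+ (δ ℚ.+ δ ℚ.+ δ) ℚ.≤ seq y K → _
  decide (inj₁ y≤x+3δ) = inj₁ (K , λ n K≤n → begin
    seq y n                                        ≤⟨ near-y K≤n ℕ.≤-refl ⟩
    seq y K ℚ.+ δ                                  ≤⟨ ℚ.+-monoˡ-≤ δ y≤x+3δ ⟩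
    seq x K ℚ.+ (δ ℚ.+ δ ℚ.+ δ) ℚ.+ δ              ≤⟨ ℚ.+-monoˡ-≤ δ (ℚ.+-monoˡ-≤ (δ ℚ.+ δ ℚ.+ δ) (near-x ℕ.≤-refl K≤n)) ⟩
    seq x n ℚ.+ δ ℚ.+ (δ ℚ.+ δ ℚ.+ δ) ℚ.+ δ        ≡⟨ solve 2 (λ x ε → let δ = con (+ 1 ℚ./ 5) :* ε in
                                                        x :+ δ :+ (δ :+ δ :+ δ) :+ δ := x :+ ε) refl (seq x n) ε ⟩
    seq x n ℚ.+ ε                                  ∎)
  decide (inj₂ x+3δ≤y) = inj₂
    ( (*≤* λ η 0<η → K , λ n K≤n → begin
        seq x n               ≡⟨ ℚ.+-identityʳ (seq x n) ⟨
        seq x n ℚ.+ 0ℚ        ≤⟨ ℚ.+-monoʳ-≤ (seq x n) (ℚ.<⇒≤ 0<δ) ⟩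
        seq x n ℚ.+ δ         ≤⟨ gap n K≤n ⟩
        seq y n               ≡⟨ ℚ.+-identityʳ (seq y n) ⟨
        seq y n ℚ.+ 0ℚ        ≤⟨ ℚ.+-monoʳ-≤ (seq y n) (ℚ.<⇒≤ 0<η) ⟩
        seq y n ℚ.+ η         ∎)
    , λ (*≤* y≤x) →
        let L , h = y≤x (½ ℚ.* δ) (½ε>0 0<δ)
            n = K ℕ.⊔ L
        in ℚ.<-irrefl refl (ℚ.<-≤-trans (½ε>0 0<δ) (begin
          ½ ℚ.* δ                                     ≡⟨ solve 2 (λ x δ → con ½ :* δ := (x :+ δ) :- (x :+ con ½ :* δ)) refl (seq x n) δ ⟩
          (seq x n ℚ.+ δ) ℚ.- (seq x n ℚ.+ ½ ℚ.* δ)   ≤⟨ ℚ.+-monoˡ-≤ _ (ℚ.≤-trans (gap n (ℕ.m≤m⊔n K L)) (h n (ℕ.m≤n⊔m K L))) ⟩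
          (seq x n ℚ.+ ½ ℚ.* δ) ℚ.- (seq x n ℚ.+ ½ ℚ.* δ)
                                                      ≡⟨ ℚ.+-inverseʳ (seq x n ℚ.+ ½ ℚ.* δ) ⟩
          0ℚ                                          ∎)))
    where
    gap : ∀ n → K ℕ.≤ n → seq x n ℚ.+ δ ℚ.≤ seq y n
    gap n K≤n = begin
      seq x n ℚ.+ δ                                ≤⟨ ℚ.+-monoˡ-≤ δ (near-x K≤n ℕ.≤-refl) ⟩
      seq x K ℚ.+ δ ℚ.+ δ                          ≡⟨ solve 2 (λ x δ → x :+ δ :+ δ := x :+ (δ :+ δ :+ δ) :- δ) refl (seq x K) δ ⟩
      seq x K ℚ.+ (δ ℚ.+ δ ℚ.+ δ) ℚ.- δ            ≤⟨ ℚ.+-monoˡ-≤ (ℚ.- δ) (ℚ.≤-trans x+3δ≤y (near-y ℕ.≤-refl K≤n)) ⟩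
      seq y n ℚ.+ δ ℚ.- δ                          ≡⟨ solve 2 (λ y δ → y :+ δ :- δ := y) refl (seq y n) δ ⟩
      seq y n                                      ∎

-- For each ε, `≤-or->` either yields the required bound or refutes x ≤ y, and the double negation
-- excludes the refutation.
≤-stable : ∀ {x y} → ¬ ¬ (x ≤ y) → x ≤ y
≤-stable {x} {y} ¬x≰y = *≤* λ ε 0<ε → case ≤-or-> y x ε 0<ε of λ where
  (inj₁ h)         → h
  (inj₂ (_ , x≰y)) → contradiction x≰y ¬x≰y

≰⇒≥ : ∀ {x y} → ¬ (x ≤ y) → y ≤ x
≰⇒≥ {x} {y} x≰y = *≤* λ ε 0<ε → case ≤-or-> x y ε 0<ε of λ where
  (inj₁ h)         → h
  (inj₂ (x≤y , _)) → contradiction x≤y x≰y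

≤-by-cases : ∀ x y {u v} → (x ≤ y → u ≤ v) → (y ≤ x → u ≤ v) → u ≤ v
≤-by-cases x y f g = ≤-stable λ u≰v → u≰v (g (≰⇒≥ (u≰v ∘ f)))

fromℚ-mono-≤ : ∀ {p q} → p ℚ.≤ q → fromℚ p ≤ fromℚ q
fromℚ-mono-≤ p≤q = pointwise-≤ λ _ → p≤q

fromℚ-cancel-≤ : ∀ {p q} → fromℚ p ≤ fromℚ q → p ℚ.≤ q
fromℚ-cancel-≤ {p} {q} (*≤* below) = ℚ.≮⇒≥ λ q<p →
  let 0<p-q = subst (ℚ._< p ℚ.- q) (ℚ.+-inverseʳ q) (ℚ.+-monoˡ-< (ℚ.- q) q<p)
      N , h = below (½ ℚ.* (p ℚ.- q)) (½ε>0 0<p-q)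
  in ℚ.<-irrefl refl (ℚ.<-≤-trans (½ε>0 0<p-q) (begin
    ½ ℚ.* (p ℚ.- q)                            ≡⟨ solve 2 (λ p q → con ½ :* (p :- q) := p :+ (:- q :- con ½ :* (p :- q))) refl p q ⟩
    p ℚ.+ (ℚ.- q ℚ.- ½ ℚ.* (p ℚ.- q))          ≤⟨ ℚ.+-monoˡ-≤ _ (h N ℕ.≤-refl) ⟩
    q ℚ.+ ½ ℚ.* (p ℚ.- q) ℚ.+ (ℚ.- q ℚ.- ½ ℚ.* (p ℚ.- q))
                                               ≡⟨ solve 2 (λ q r → q :+ r :+ (:- q :- r) := con 0ℚ) refl q (½ ℚ.* (p ℚ.- q)) ⟩
    0ℚ                                         ∎))
  where
  open ℚ.≤-Reasoning
  open +-*-Solver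

infix 8 -_
infixl 6 _-_

-- As a product with -1 the negation inherits its Cauchy modulus from `_*_`.
-_ : ℝ → ℝ
- x = fromℤ ℤ.-1ℤ * x

_-_ : ℝ → ℝ → ℝ
x - y = x + - y

ℝ-commutativeRing : CommutativeRing 0ℓ 0ℓ
ℝ-commutativeRing = record
  { Carrier = ℝ ; _≈_ = _≃_ ; _+_ = _+_ ; _*_ = _*_ ; -_ = -_ ; 0# = 0ℝ ; 1# = 1ℝ
  ; isCommutativeRing = record
    { isRing = record
      { +-isAbelianGroup = record
        { isGroup = record
          { isMonoid = record
            { isSemigroup = record
              { isMagma = record
                { isEquivalence = record
                    { refl  = λ {x} → ≃-refl {x}
                    ; sym   = λ {x} {y} → ≃-sym {x} {y}
                    ; trans = λ {x} {y} {z} → ≃-trans {x} {y} {z}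
                    }
                ; ∙-cong = λ {x} {y} {u} {v} → +-cong {x} {y} {u} {v}
                }
              ; assoc = λ x y z → pointwise λ n → ℚ.+-assoc (seq x n) (seq y n) (seq z n)
              }
            ; identity = (λ x → pointwise λ n → ℚ.+-identityˡ (seq x n))
                       , (λ x → pointwise λ n → ℚ.+-identityʳ (seq x n))
            }
          ; inverse =
              (λ x → pointwise λ n →
                 solve 1 (λ a → con (ℚ.- 1ℚ) :* a :+ a := con 0ℚ) refl (seq x n))
            , (λ x → pointwise λ n →
                 solve 1 (λ a → a :+ con (ℚ.- 1ℚ) :* a := con 0ℚ) refl (seq x n))
          ; ⁻¹-cong = λ {x} {y} → *-cong {fromℤ ℤ.-1ℤ} {fromℤ ℤ.-1ℤ} {x} {y} (≃-refl {fromℤ ℤ.-1ℤ})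
          }
        ; comm = λ x y → pointwise λ n → ℚ.+-comm (seq x n) (seq y n)
        }
      ; *-cong = λ {x} {y} {u} {v} → *-cong {x} {y} {u} {v}
      ; *-assoc = λ x y z → pointwise λ n → ℚ.*-assoc (seq x n) (seq y n) (seq z n)
      ; *-identity = (λ x → pointwise λ n → ℚ.*-identityˡ (seq x n))
                   , (λ x → pointwise λ n → ℚ.*-identityʳ (seq x n))
      ; distrib = (λ x y z → pointwise λ n → ℚ.*-distribˡ-+ (seq x n) (seq y n) (seq z n))
                , (λ x y z → pointwise λ n → ℚ.*-distribʳ-+ (seq x n) (seq y n) (seq z n))
      }
    ; *-comm = *-comm
    }
  }
  where open +-*-Solver

private
  fromℤᵘ : ℤ → ℚᵘ
  fromℤᵘ k = mkℚᵘ k 0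

-- Normalisation by a gcd does not compute on variables; among unnormalised fractions over 1 the
-- claim is integer arithmetic.
fromℤ-+-homo : ∀ a b → fromℤ (a ℤ.+ b) ≃ fromℤ a + fromℤ b
fromℤ-+-homo a b = pointwise λ _ → ℚ.toℚᵘ-injective (begin
  toℚᵘ (fromℚᵘ (fromℤᵘ (a ℤ.+ b)))                  ≈⟨ ℚ.toℚᵘ-fromℚᵘ (fromℤᵘ (a ℤ.+ b)) ⟩
  fromℤᵘ (a ℤ.+ b)                                  ≡⟨ cong fromℤᵘ (cong₂ ℤ._+_ (sym (ℤ.*-identityʳ a)) (sym (ℤ.*-identityʳ b))) ⟩
  fromℤᵘ a ℚᵘ.+ fromℤᵘ b                                 ≈⟨ ℚᵘ.+-cong (ℚ.toℚᵘ-fromℚᵘ (fromℤᵘ a)) (ℚ.toℚᵘ-fromℚᵘ (fromℤᵘ b)) ⟨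
  toℚᵘ (fromℚᵘ (fromℤᵘ a)) ℚᵘ.+ toℚᵘ (fromℚᵘ (fromℤᵘ b)) ≈⟨ ℚ.toℚᵘ-homo-+ (fromℚᵘ (fromℤᵘ a)) (fromℚᵘ (fromℤᵘ b)) ⟨
  toℚᵘ (fromℚᵘ (fromℤᵘ a) ℚ.+ fromℚᵘ (fromℤᵘ b))         ∎)
  where open import Relation.Binary.Reasoning.Setoid ℚᵘ.≃-setoid

fromℤ-*-homo : ∀ a b → fromℤ (a ℤ.* b) ≃ fromℤ a * fromℤ b
fromℤ-*-homo a b = pointwise λ _ → ℚ.toℚᵘ-injective (begin
  toℚᵘ (fromℚᵘ (fromℤᵘ (a ℤ.* b)))                  ≈⟨ ℚ.toℚᵘ-fromℚᵘ (fromℤᵘ (a ℤ.* b)) ⟩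
  fromℤᵘ a ℚᵘ.* fromℤᵘ b                                 ≈⟨ ℚᵘ.*-cong (ℚ.toℚᵘ-fromℚᵘ (fromℤᵘ a)) (ℚ.toℚᵘ-fromℚᵘ (fromℤᵘ b)) ⟨
  toℚᵘ (fromℚᵘ (fromℤᵘ a)) ℚᵘ.* toℚᵘ (fromℚᵘ (fromℤᵘ b)) ≈⟨ ℚ.toℚᵘ-homo-* (fromℚᵘ (fromℤᵘ a)) (fromℚᵘ (fromℤᵘ b)) ⟨
  toℚᵘ (fromℚᵘ (fromℤᵘ a) ℚ.* fromℚᵘ (fromℤᵘ b))         ∎)
  where open import Relation.Binary.Reasoning.Setoid ℚᵘ.≃-setoid

fromℤ-neg-homo : ∀ a → fromℤ (ℤ.- a) ≃ - fromℤ a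
fromℤ-neg-homo a = ≃-trans {fromℤ (ℤ.- a)} {fromℤ (ℤ.-1ℤ ℤ.* a)} { - fromℤ a }
  (pointwise λ _ → cong (ℚ._/ 1) (sym (ℤ.-1*i≡-i a))) (fromℤ-*-homo ℤ.-1ℤ a)

fromℤ-mono-≤ : ∀ {a b} → a ℤ.≤ b → fromℤ a ≤ fromℤ b
fromℤ-mono-≤ {a} {b} a≤b = fromℚ-mono-≤ (ℚ.toℚᵘ-cancel-≤ (begin
  toℚᵘ (fromℚᵘ (mkℚᵘ a 0)) ≃⟨ ℚ.toℚᵘ-fromℚᵘ (mkℚᵘ a 0) ⟩
  mkℚᵘ a 0                 ≤⟨ ℚᵘ.*≤* (ℤ.*-monoʳ-≤-nonNeg (+ 1) a≤b) ⟩
  mkℚᵘ b 0                 ≃⟨ ℚ.toℚᵘ-fromℚᵘ (mkℚᵘ b 0) ⟨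
  toℚᵘ (fromℚᵘ (mkℚᵘ b 0)) ∎))
  where open ℚᵘ.≤-Reasoning

fromℤ-cancel-≤ : ∀ {a b} → fromℤ a ≤ fromℤ b → a ℤ.≤ b
fromℤ-cancel-≤ {a} {b} h = ℤ.*-cancelʳ-≤-pos a b (+ 1) (ℚᵘ.drop-*≤* (begin
  mkℚᵘ a 0                 ≃⟨ ℚ.toℚᵘ-fromℚᵘ (mkℚᵘ a 0) ⟨
  toℚᵘ (fromℚᵘ (mkℚᵘ a 0)) ≤⟨ ℚ.toℚᵘ-mono-≤ (fromℚ-cancel-≤ h) ⟩
  toℚᵘ (fromℚᵘ (mkℚᵘ b 0)) ≃⟨ ℚ.toℚᵘ-fromℚᵘ (mkℚᵘ b 0) ⟩
  mkℚᵘ b 0                 ∎))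
  where open ℚᵘ.≤-Reasoning

-- The equation keeps the type free of closed reals, which are expensive to compare.
reciprocal : ∀ n x → x ≡ fromℕ (suc n) → ∃ λ ε → 0ℚ ℚ.< ε × fromℚ ε * x ≃ 1ℝ
reciprocal n _ refl = ε , proj₁ (proj₂ n/1-quotient) ,
  pointwise {fromℚ ε * fromℕ (suc n)} {1ℝ} λ _ →
    trans (ℚ.*-comm ε (+ suc n ℚ./ 1)) (proj₂ (proj₂ n/1-quotient))
  where
  n/1-quotient : ∃ λ ε → 0ℚ ℚ.< ε × (+ suc n ℚ./ 1) ℚ.* ε ≡ 1ℚ
  n/1-quotient = quotient (ℚ.positive⁻¹ (+ suc n ℚ./ 1) {{ℚ.normalize-pos (suc n) 1}}) (ℚ.positive⁻¹ 1ℚ)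
  ε : ℚ
  ε = proj₁ n/1-quotient

ℝ-orderedRing : OrderedRing
ℝ-orderedRing = record
  { commutativeRing = ℝ-commutativeRing
  ; _≤_ = _≤_ ; ≤-reflexive = λ {x} {y} → ≃⇒≤ {x} {y}
  ; ≤-trans = λ {x} {y} {z} → ≤-trans {x} {y} {z}
  ; +-mono-≤ = λ {x} {y} {u} {v} → +-mono-≤ {x} {y} {u} {v}
  ; *-nonNeg = λ {x} {y} → *-nonNeg {x} {y} ; ≤-by-cases = λ x y {u} {v} → ≤-by-cases x y {u} {v}
  ; ι = fromℤ ; ι-+-homo = fromℤ-+-homo ; ι-*-homo = fromℤ-*-homo ; ι-neg-homo = fromℤ-neg-homo
  ; ι-0-homo = ≃-refl {0ℝ} ; ι-1-homo = ≃-refl {1ℝ}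
  ; ι-mono-≤ = fromℤ-mono-≤ ; ι-cancel-≤ = fromℤ-cancel-≤
  }

module ℝO = OrderedRingProperties ℝ-orderedRing
open ℝO using (Balanced; isBalanced; NonNegativeOn; isNonNegativeOn; AffineCombination; affine;
  ConvexCombination; convex; IsPositiveInverse; positiveInverse; generator-convex)

sum≃sum : ∀ n (f : Vector ℝ n) → sum f ≃ ℝO.sum f
sum≃sum zero    f = ≃-refl {0ℝ}
sum≃sum (suc n) f = +-cong {f zero} {f zero} {sum (f ∘ suc)} {ℝO.sum (f ∘ suc)}
  (≃-refl {f zero}) (sum≃sum n (f ∘ suc))

combination≃sum : ∀ {n d} (w : Vector ℝ n) (v : Fin n → Point d) j →
  combination w v j ≃ ℝO.sum (λ i → w i * v i j)
combination≃sum {n} w v j = sum≃sum n (λ i → w i * v i j)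

ConvexCombination⇒ConvexHull : ∀ {n d} (v : Fin n → Point d) x →
  ConvexCombination v x → ConvexHull v x
ConvexCombination⇒ConvexHull {n} v x (convex (affine w Σw≃1 x≃) 0≤w) =
  w , 0≤w , ≃-trans {sum w} {ℝO.sum w} {1ℝ} (sum≃sum n w) Σw≃1 ,
  λ j → ≃-trans {x j} {ℝO.sum (λ i → w i * v i j)} {combination w v j} (x≃ j)
    (≃-sym {combination w v j} {ℝO.sum (λ i → w i * v i j)} (combination≃sum w v j))

ConvexHull⇒ConvexCombination : ∀ {n d} (v : Fin n → Point d) x →
  ConvexHull v x → ConvexCombination v x
ConvexHull⇒ConvexCombination {n} v x (w , 0≤w , Σw≃1 , x≃) = convex
  (affine w (≃-trans {ℝO.sum w} {sum w} {1ℝ} (≃-sym {sum w} {ℝO.sum w} (sum≃sum n w)) Σw≃1)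
    (λ j → ≃-trans {x j} {combination w v j} {ℝO.sum (λ i → w i * v i j)} (x≃ j)
      (combination≃sum w v j)))
  0≤w

AffineCombination⇒AffineHull : ∀ {n d} (A : Point d → Set) (v : Fin n → Point d) x →
  (∀ i → A (v i)) → AffineCombination v x → AffineHull A x
AffineCombination⇒AffineHull {n} A v x v∈A (affine w Σw≃1 x≃) =
  n , v , w , v∈A , ≃-trans {sum w} {ℝO.sum w} {1ℝ} (sum≃sum n w) Σw≃1 ,
  λ j → ≃-trans {x j} {ℝO.sum (λ i → w i * v i j)} {combination w v j} (x≃ j)
    (≃-sym {combination w v j} {ℝO.sum (λ i → w i * v i j)} (combination≃sum w v j))

-- Lattice simplices

generators : ∀ {d} (P : LatticePolytope d) → Fin (LatticePolytope.size P) → Point d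
generators P i = toPoint (LatticePolytope.points P i)

convex⇒∈ : ∀ {d} (P : LatticePolytope d) x → ConvexCombination (generators P) x → ⟦ P ⟧ x
convex⇒∈ P x = ConvexCombination⇒ConvexHull (generators P) x

∈⇒convex : ∀ {d} (P : LatticePolytope d) x → ⟦ P ⟧ x → ConvexCombination (generators P) x
∈⇒convex P x = ConvexHull⇒ConvexCombination (generators P) x

sumℤ-nonNeg : ∀ {n} (f : Vector ℤ n) → (∀ i → + 0 ℤ.≤ f i) → + 0 ℤ.≤ sumℤ f
sumℤ-nonNeg {zero}  f 0≤f = ℤ.≤-refl
sumℤ-nonNeg {suc n} f 0≤f = ℤ.+-mono-≤ (0≤f zero) (sumℤ-nonNeg (f ∘ suc) (0≤f ∘ suc))

i≤i+j : ∀ {i j} → + 0 ℤ.≤ j → i ℤ.≤ i ℤ.+ j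
i≤i+j {i} 0≤j = ℤ.≤-trans (ℤ.≤-reflexive (sym (ℤ.+-identityʳ i))) (ℤ.+-monoʳ-≤ i 0≤j)

summand≤sumℤ : ∀ {n} (f : Vector ℤ n) → (∀ i → + 0 ℤ.≤ f i) → ∀ i → f i ℤ.≤ sumℤ f
summand≤sumℤ {suc n} f 0≤f zero    = i≤i+j (sumℤ-nonNeg (f ∘ suc) (0≤f ∘ suc))
summand≤sumℤ {suc n} f 0≤f (suc i) = ℤ.≤-trans (summand≤sumℤ (f ∘ suc) (0≤f ∘ suc) i)
  (ℤ.≤-trans (i≤i+j (0≤f zero)) (ℤ.≤-reflexive (ℤ.+-comm _ (f zero))))

simplex : ∀ {d} → Vector ℕ d → LatticePolytope d
simplex {d} q = record { size = suc d ; points = simplexPoints q }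

isPositiveInverse : ∀ y x → 0ℝ ≤ y → y * x ≃ 1ℝ → IsPositiveInverse y x
isPositiveInverse y x 0≤y yx≃1 = positiveInverse {y} {x} 0≤y yx≃1

-- The inverse is kept rational because it also serves as the radius of a ball in `Interior`.
PositiveInverse : ℝ → Set
PositiveInverse x = ∃ λ ε → 0ℚ ℚ.< ε × IsPositiveInverse (fromℚ ε) x

inverse : ∀ n x → x ≡ fromℕ (suc n) → PositiveInverse x
inverse n x x≡ = pack (reciprocal n x x≡)
  where
  pack : (∃ λ ε → 0ℚ ℚ.< ε × fromℚ ε * x ≃ 1ℝ) → PositiveInverse x
  pack (ε , 0<ε , εx≃1) = ε , 0<ε , isPositiveInverse (fromℚ ε) x (fromℚ-mono-≤ {0ℚ} {ε} (ℚ.<⇒≤ 0<ε)) εx≃1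

module _ {d : ℕ} (q : Vector ℕ d) where
  open Barycentric ℝ-orderedRing q

  V⁻¹ : PositiveInverse V
  V⁻¹ = inverse (sumℕ q) V refl

  vertex∈simplex : ∀ i → ⟦ simplex q ⟧ (generators (simplex q) i)
  vertex∈simplex i = convex⇒∈ (simplex q) (generators (simplex q) i)
    (generator-convex (generators (simplex q)) i)

  simplex-fullDimensional : FullDimensional (simplex q)
  simplex-fullDimensional x = AffineCombination⇒AffineHull ⟦ simplex q ⟧ (generators (simplex q)) x
    vertex∈simplex (Weights.affine-weights (proj₂ (proj₂ V⁻¹)) x)

  slack-sum : ∀ m z → slack₀ q m z ℤ.+ sumℤ (slack q m z) ≡ + volume q ℤ.* + m
  slack-sum m z = trans
    (cong (ℤ._+_ (slack₀ q m z)) (trans (ℤ∑.∑-distrib-+ (λ j → + volume q ℤ.* lookup z j) _)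
      (cong₂ ℤ._+_ (sym (ℤ∑.*-distribˡ-sum (+ volume q) (lookup z)))
        (trans (sym (ℤ∑.*-distribʳ-sum (slack₀ q m z) (+_ ∘ q))) (cong (ℤ._* slack₀ q m z) (sym (+-sumℕ q)))))))
    (identity (+ m) (sumℤ (lookup z)) (+ sumℕ q))
    where
    identity : ∀ m s q → (m ℤ.- s) ℤ.+ ((+ 1 ℤ.+ q) ℤ.* s ℤ.+ q ℤ.* (m ℤ.- s)) ≡ (+ 1 ℤ.+ q) ℤ.* m
    identity = solve-∀

  -- By `slack-sum` the slacks add up to N m = 0; being nonnegative, all of them vanish. The level m
  -- = 0 is separate because the other levels divide z by m.
  InCone-zero : ∀ z → InCone q 0 z → ∀ j → lookup z j ≡ + 0
  InCone-zero z (0≤s₀ , 0≤s) j =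
    [ (λ ()) , id ]′ (ℤ.i*j≡0⇒i≡0∨j≡0 (+ volume q) (trans (sym slack≡V*z) slack≡0))
    where
    total≡0 : slack₀ q 0 z ℤ.+ sumℤ (slack q 0 z) ≡ + 0
    total≡0 = trans (slack-sum 0 z) (ℤ.*-zeroʳ (+ volume q))
    slack₀≡0 : slack₀ q 0 z ≡ + 0
    slack₀≡0 = ℤ.≤-antisym (ℤ.≤-trans (i≤i+j 0≤Σs) (ℤ.≤-reflexive total≡0)) 0≤s₀
      where
      0≤Σs : + 0 ℤ.≤ sumℤ (slack q 0 z)
      0≤Σs = sumℤ-nonNeg (slack q 0 z) 0≤s
    slack≡0 : slack q 0 z j ≡ + 0
    slack≡0 = ℤ.≤-antisym (ℤ.≤-trans (summand≤sumℤ (slack q 0 z) 0≤s j)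
      (ℤ.≤-reflexive (trans (sym (ℤ.+-identityˡ _))
        (trans (cong (ℤ._+ sumℤ (slack q 0 z)) (sym slack₀≡0)) total≡0)))) (0≤s j)
    slack≡V*z : slack q 0 z j ≡ + volume q ℤ.* lookup z j
    slack≡V*z = trans (cong (λ s → + volume q ℤ.* lookup z j ℤ.+ + q j ℤ.* s) slack₀≡0)
      (trans (cong (ℤ._+_ (+ volume q ℤ.* lookup z j)) (ℤ.*-zeroʳ (+ q j))) (ℤ.+-identityʳ _))

  ∈Dilate⇒InCone : ∀ m z → Dilate m ⟦ simplex q ⟧ (toPoint z) → InCone q m z
  ∈Dilate⇒InCone m z (p , p∈ , z≃mp) = convex⇒InCone m z p (∈⇒convex (simplex q) p p∈) z≃mp

  InCone⇒∈Dilate : ∀ m z → InCone q m z → Dilate m ⟦ simplex q ⟧ (toPoint z)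
  -- Dilation by 0 sends every point of the simplex to the origin, so any vertex is a witness.
  InCone⇒∈Dilate zero z z∈ = generators (simplex q) zero , vertex∈simplex zero , λ j →
    subst (λ k → fromℤ k ≃ fromℕ 0 * generators (simplex q) zero j) (sym (InCone-zero z z∈ j))
      (0≃0* (generators (simplex q) zero j))
    where
    0≃0* : ∀ x → 0ℝ ≃ 0ℝ * x
    0≃0* x = pointwise {0ℝ} {0ℝ * x} λ n → sym (ℚ.*-zeroˡ (seq x n))
  InCone⇒∈Dilate (suc m) z z∈ = pack
    (InCone⇒convex (proj₂ (proj₂ V⁻¹)) (suc m) (proj₂ (proj₂ (inverse m (fromℕ (suc m)) refl))) z z∈)
    where
    pack : (∃ λ x → ConvexCombination (generators (simplex q)) x ×
                    (∀ j → fromℤ (lookup z j) ≃ fromℕ (suc m) * x j)) →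
           Dilate (suc m) ⟦ simplex q ⟧ (toPoint z)
    pack (x , x∈ , z≃mx) = x , convex⇒∈ (simplex q) x x∈ , z≃mx

  ehrhartFunction : ℕ → ℕ
  ehrhartFunction m = length (codes q m)

  simplex-ehrhart : IsEhrhartFunction (simplex q) ehrhartFunction
  simplex-ehrhart m = conePoints q m , conePoints-unique q m ,
    (λ z → mk⇔ (InCone⇒∈Dilate m z ∘ ∈-conePoints⁻ q m) (∈-conePoints⁺ q m ∘ ∈Dilate⇒InCone m z)) ,
    List.length-map (decode q) (codes q m)

  heights : List ℕ
  heights = List.map (height q ∘ toℕ) (allFin (volume q))

  simplex-hStar : ∀ h → (∀ k → + totalCount 0 heights k ≡ polynomial h k) → IsHStar (simplex q) h
  simplex-hStar h h≡ = ehrhartFunction , simplex-ehrhart , λ k → trans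
    (power-1-t⊛ (suc d) _ k)
    (trans (Δ^-cong (suc d) (cong +_ ∘ length-codes q) k) (trans (Δ^-totalCount (suc d) heights k) (h≡ k)))

  simplex-interiorLatticePoint : (∀ j → 1 ℕ.≤ q j) → HasInteriorLatticePoint (simplex q)
  simplex-interiorLatticePoint 1≤q = replicate d (+ 0) , pack
    (inverse (sumℕ q ℕ.+ d) (fromℕ (volume q ℕ.+ d)) refl)
    where
    pack : PositiveInverse (fromℕ (volume q ℕ.+ d)) → Interior ⟦ simplex q ⟧ (toPoint (replicate d (+ 0)))
    pack (ε , 0<ε , ε-inverse) = ε , 0<ε , λ y near →
      convex⇒∈ (simplex q) y (near-0⇒convex 1≤q (proj₂ (proj₂ V⁻¹)) ε-inverse y near)

-- A weight 1 contributes ⌊r/N⌋ = 0 for r < N, so only the larger weights lower the height and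
-- repeat values. In the first row N = 12 and the height is r - ⌊r/2⌋, which takes each value from 1
-- to 5 twice.
simplexWeights : Fin 6 → Vector ℕ 6
simplexWeights 0F = lookup (1 ∷ 1 ∷ 1 ∷ 1 ∷ 1 ∷ 6 ∷ [])
simplexWeights 1F = lookup (1 ∷ 1 ∷ 1 ∷ 1 ∷ 1 ∷ 2 ∷ [])
simplexWeights 2F = lookup (1 ∷ 1 ∷ 1 ∷ 1 ∷ 2 ∷ 2 ∷ [])
simplexWeights 3F = lookup (1 ∷ 1 ∷ 1 ∷ 1 ∷ 1 ∷ 3 ∷ [])
simplexWeights 4F = lookup (1 ∷ 1 ∷ 1 ∷ 1 ∷ 1 ∷ 4 ∷ [])
simplexWeights 5F = lookup (1 ∷ 1 ∷ 1 ∷ 1 ∷ 4 ∷ 10 ∷ [])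

simplexWeights-positive : ∀ i j → 1 ℕ.≤ simplexWeights i j
simplexWeights-positive = from-yes (Fin.all? λ i → Fin.all? λ j → 1 ℕ.≤? simplexWeights i j)

simplex-hStar-table : ∀ {d} (q : Vector ℕ d) h →
  tabulate (λ i → + totalCount 0 (heights q) (toℕ i)) ≡ h →
  (∀ k → totalCount 0 (heights q) (suc d ℕ.+ k) ≡ 0) → IsHStar (simplex q) h
simplex-hStar-table {d} q _ refl vanishes = simplex-hStar q (tabulate (λ i → + totalCount 0 (heights q) (toℕ i)))
  (polynomial-tabulate (suc d) (+_ ∘ totalCount 0 (heights q)) (cong +_ ∘ vanishes))

simplex-hStars : ∀ i → IsHStar (simplex (simplexWeights i)) (hStars i)
-- Both parts hold by evaluation. The heights are numerals at most 6, so at index 7 + k each one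
-- leaves a positive number to be composed from zero parts, which yields the empty list.
simplex-hStars 0F = simplex-hStar-table (simplexWeights 0F) (hStars 0F) refl λ _ → refl
simplex-hStars 1F = simplex-hStar-table (simplexWeights 1F) (hStars 1F) refl λ _ → refl
simplex-hStars 2F = simplex-hStar-table (simplexWeights 2F) (hStars 2F) refl λ _ → refl
simplex-hStars 3F = simplex-hStar-table (simplexWeights 3F) (hStars 3F) refl λ _ → refl
simplex-hStars 4F = simplex-hStar-table (simplexWeights 4F) (hStars 4F) refl λ _ → refl
simplex-hStars 5F = simplex-hStar-table (simplexWeights 5F) (hStars 5F) refl λ _ → refl

balanced : ∀ {n} (a : Vector ℝ n) → sum a ≃ 0ℝ → Balanced a
balanced {n} a Σa≃0 = isBalanced
  (≃-trans {ℝO.sum a} {sum a} {0ℝ} (≃-sym {sum a} {ℝO.sum a} (sum≃sum n a)) Σa≃0)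

nonNegativeOn : ∀ {n} (a v : Vector ℝ n) → 0ℝ ≤ a · v → NonNegativeOn a v
nonNegativeOn {n} a v 0≤a·v = isNonNegativeOn (≤-trans {0ℝ} {a · v} {ℝO.sum (λ i → a i * v i)} 0≤a·v
  (≃⇒≤ {a · v} {ℝO.sum (λ i → a i * v i)} (sum≃sum n (λ i → a i * v i))))

nonNegativeOn⁻¹ : ∀ {n} (a v : Vector ℝ n) → NonNegativeOn a v → 0ℝ ≤ a · v
nonNegativeOn⁻¹ {n} a v (isNonNegativeOn 0≤sum) = ≤-trans {0ℝ} {ℝO.sum (λ i → a i * v i)} {a · v} 0≤sum
  (≃⇒≤ {ℝO.sum (λ i → a i * v i)} {a · v}
    (≃-sym {a · v} {ℝO.sum (λ i → a i * v i)} (sum≃sum n (λ i → a i * v i))))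

nonNegativeOn-hStars : ∀ α → StrictlyBalancedInequality 6 α → ∀ i → NonNegativeOn α (hVector (hStars i))
nonNegativeOn-hStars α (_ , valid) i = nonNegativeOn α (hVector (hStars i))
  (valid (simplex (simplexWeights i)) (simplex-fullDimensional (simplexWeights i))
    (simplex-interiorLatticePoint (simplexWeights i) (simplexWeights-positive i))
    (hStars i) (simplex-hStars i))

theorem1p21 : ∀ (α : Vector ℝ 6) → StrictlyBalancedInequality 6 α →
    DeducibleFrom InequalitySystem α
theorem1p21 α inequality x ((h₆≤h₁ , h₁≤h₅ , h₅≤h₂) , (h₁+h₂≤h₄+h₅ , h₄+h₅≤h₂+h₃) , h₁+h₂≤h₃+h₄) =
  nonNegativeOn⁻¹ α x (Cone.nonNeg-on-cone ℝ-orderedRing α x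
    (balanced α (proj₁ inequality)) (nonNegativeOn-hStars α inequality)
    h₆≤h₁ h₁≤h₅ h₅≤h₂ h₁+h₂≤h₄+h₅ h₄+h₅≤h₂+h₃ h₁+h₂≤h₃+h₄)
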